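{- Let $b,k,m$ be positive integers with $m\ge 5$. Then, modulo $5^{m+5}$, $$S_{k\varphi(5^m)+b}-(1+5^b)S_b\equiv\begin{cases} 5^{m-1}k(930-4875b-4625b^2-6250b^3-3125b^4)&\text{if } b\equiv 0\pmod 4,\\ 5^{m-1}k(4670+1450b+1250b^2+6250b^3+3125b^4+6250b^5)&\text{if } b\equiv 1\pmod 4,\\ 5^{m-1}k(-4235+3700b-3000b^2+6250b^3-9375b^4+6250b^5)&\text{if } b\equiv 2\pmod 4,\\ 5^{m-1}k(3725-1025b-2625b^2+6250b^3+3125b^5)&\text{if } b\equiv 3\pmod 4.\end{cases}$$
   Context: The integer sequence $\{S_n\}_{n\ge0}$ is defined by $S_0=1$ and $S_n=1-\sum_{j=0}^{n-1}\binom{n}{j}2^{2n-2j-1}S_j$ for $n\ge 1$. $\varphi$ denotes Euler's totient function. -}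

module Defs where

open import Data.Fin.Base using (Fin; toℕ)
open import Data.Fin.Properties using (toℕ<n)
open import Data.Integer.Base as ℤ using (ℤ; +_)
import Data.Integer.Properties as ℤ
import Data.Integer.Divisibility.Signed as ℤ
open import Data.List.Base using (length; filter; applyUpTo)
open import Data.Nat.Base using (ℕ; zero; suc; _<_; _*_; _∸_)
open import Data.Nat.Combinatorics using (_C_)
open import Data.Nat.Coprimality using (coprime?)
open import Data.Nat.Induction using (<-rec; <-wellFounded)
import Induction.WellFounded as WF
open import Relation.Binary.PropositionalEquality using (_≡_; refl; cong)

open import Algebra.Properties.CommutativeMonoid.Sum ℤ.+-0-commutativeMonoid
  using (sum-cong-≗; sum-syntax)

-- For j < n the exponent 2n − 2j − 1 is nonnegative, so the truncated
-- subtractions are exact.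
coeff : ℕ → ℕ → ℤ
coeff n j = + (n C j) ℤ.* (+ 2) ℤ.^ (2 * n ∸ 2 * j ∸ 1)

S-step : ∀ n → (∀ {j} → j < n → ℤ) → ℤ
S-step zero    _   = + 1
S-step (suc n) rec =
  + 1 ℤ.- (∑[ j < suc n ] (coeff (suc n) (toℕ j) ℤ.* rec (toℕ<n j)))

S : ℕ → ℤ
S = <-rec (λ _ → ℤ) S-step

-- The two defining equations of the sequence; the second is not definitional
-- because S is defined by well-founded recursion.
S-zero : S 0 ≡ + 1
S-zero = refl

S-suc : ∀ n → S (suc n) ≡
  + 1 ℤ.- (∑[ j < suc n ] (coeff (suc n) (toℕ j) ℤ.* S (toℕ j)))
S-suc n = WF.FixPoint.unfold-wfRec <-wellFounded (λ _ → ℤ) S-step S-step-ext {suc n}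
  where
  S-step-ext : ∀ n {f g : ∀ {j} → j < n → ℤ} →
               (∀ {j} (j<n : j < n) → f j<n ≡ g j<n) → S-step n f ≡ S-step n g
  S-step-ext zero    _   = refl
  S-step-ext (suc n) f≗g = cong (λ s → + 1 ℤ.- s)
    (sum-cong-≗ {suc n} (λ j → cong (coeff (suc n) (toℕ j) ℤ.*_) (f≗g (toℕ<n j))))

-- applyUpTo suc n is the list 1, 2, …, n.
φ : ℕ → ℕ
φ n = length (filter (λ i → coprime? i n) (applyUpTo suc n))

infix 4 _≡_[mod_]
_≡_[mod_] : ℤ → ℤ → ℕ → Set
x ≡ y [mod n ] = + n ℤ.∣ x ℤ.- y

{-# OPTIONS --safe #-}

-- Write x = 4i + 1 and y = x⁴. Modulo an odd N, S n is the alternating sum of xⁿ over i < N, because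
-- both satisfy the recurrence of S (telescoping). The multiples of 5 among the x contribute
-- − 5ⁿ S n, so the alternating sum Σ′ over the x prime to 5 gives (1 + 5ⁿ) S n. There y = 1 + 5v, and
-- y ^ (5^(m−1) k) ≡ 1 + 5^(m−1) k log y modulo 5^(m+5), which reduces the claim to the value of
-- Σ′ ± x^b log y modulo 5⁶. As a function of t, where b = r + 4t, that value has vanishing fifth
-- differences because y − 1 and log y are divisible by 5; so does the claimed polynomial,
-- and the two agree for t < 5, which is a computation with S n mod 5⁷ for n < 40.

module Submission where

-- In umbral notation the recurrence says (4 + S)ⁿ + Sⁿ = 2, that is, S n = 4ⁿ Eₙ(1/4) with the
-- Euler polynomial Eₙ; hence the progression x = 4i + 1.
--
-- An alternating sum of M terms, M odd, gives S n modulo M only. The terms divisible by 5 form such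
-- a sum inside one of 5M terms, and their factor 5ⁿ, n ≥ 1, restores the modulus 5M. At the
-- exponent n = kφ(5^m) + b the factor 1 + 5ⁿ is 1 modulo 5^(m+5), so it survives only at S b.
--
-- The bound m ≥ 5 enters twice: ((1 + 5v)^(5ⁿ) - 1) / 5^(n+1) is constant modulo 5⁵ only from n = 4
-- on, and it is used at n = m - 1; and the square of 5^m has to vanish modulo 5^(m+5).
--
-- The term (y - 1)⁵ / 5 of the logarithm is not an integral polynomial in y. Therefore 5 log y
-- modulo 5⁷ takes the place of log y modulo 5⁶. Its expansion in powers of y is integral, so a sum
-- weighted by it is a combination of six power sums, each known from S.

open import Defs using (S; S-suc; coeff; φ; _≡_[mod_])
open import Data.Fin.Base as Fin using (Fin; toℕ; fromℕ; inject₁)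
import Data.Fin.Properties as Fin
open import Data.Integer.Base using (ℤ; +_; -_; _+_; _-_; _*_; _^_; ∣_∣; +-*-rawSemiring)
import Data.Integer.Divisibility.Signed as ℤ
import Data.Integer.Properties as ℤ
open import Data.Integer.Tactic.RingSolver using (solve-∀)
open import Data.List.Base using (List; []; _∷_; _++_; length; filter; applyUpTo)
import Data.List.Properties as List
open import Data.Nat.Base as ℕ using (ℕ; zero; suc; _≤_; _<_; _∸_; _%_; z≤n; s≤s)
open import Data.Nat.Combinatorics using (_C_; nCn≡1)
open import Data.Nat.Coprimality as Coprimality using (Coprime; coprime?)
import Data.Nat.Divisibility as ℕ
open import Data.Nat.DivMod using (m≡m%n+[m/n]*n)
open import Data.Nat.Induction using (<-rec)
open import Data.Nat.Primality using (prime?; prime⇒irreducible)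
import Data.Nat.Properties as ℕ
open import Data.Nat.Tactic.RingSolver using () renaming (solve-∀ to ℕ-solve-∀)
open import Data.Product.Base using (_×_; _,_; ∃; proj₁; proj₂)
open import Data.Sum.Base using (inj₁; inj₂)
open import Relation.Binary.PropositionalEquality
  using (_≡_; refl; sym; trans; cong; cong₂; subst; subst₂; module ≡-Reasoning)
open import Relation.Nullary using (¬_; contradiction)
open import Relation.Nullary.Decidable using (from-yes; from-no)
open import Relation.Unary using (Pred; Decidable)
open import Algebra.Properties.Semiring.Sum ℤ.+-*-semiring
  using (sum-syntax; sum-cong-≗; sum-init-last; *-distribˡ-sum)
import Algebra.Properties.CommutativeSemiring.Binomial ℤ.+-*-commutativeSemiring as Binomial
import Algebra.Definitions.RawSemiring +-*-rawSemiring as Raw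

-- Congruences and alternating sums

-- A record, unlike _≡_[mod_], lets Agda infer both sides of a congruence.
infix 4 _≋_[_]
infix 3 _by_
record _≋_[_] (x y : ℤ) (n : ℕ) : Set where
  constructor _by_
  field
    quotient : ℤ
    equality : x ≡ y + quotient * + n

open _≋_[_]

≋⇒mod : ∀ {n x y} → x ≋ y [ n ] → x ≡ y [mod n ]
≋⇒mod {n} {_} {y} (q by refl) = ℤ.divides q (lemma y (q * + n))
  where
  lemma : ∀ y z → y + z - y ≡ z
  lemma = solve-∀

∣⇒≋0 : ∀ {n x} → n ℕ.∣ ∣ x ∣ → x ≋ + 0 [ n ]
∣⇒≋0 {n} {x} n∣x with ℤ.divides q eq ← ℤ.∣ᵤ⇒∣ {+ n} {x} n∣x =
  q by trans eq (sym (ℤ.+-identityˡ (q * + n)))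

≡⇒≋ : ∀ {n x y} → x ≡ y → x ≋ y [ n ]
≡⇒≋ {x = x} refl = + 0 by sym (ℤ.+-identityʳ x)

≋-sym : ∀ {n x y} → x ≋ y [ n ] → y ≋ x [ n ]
≋-sym {n} {_} {y} (q by refl) = (- q) by lemma y q (+ n)
  where
  lemma : ∀ y q n → y ≡ y + q * n + - q * n
  lemma = solve-∀

≋-trans : ∀ {n x y z} → x ≋ y [ n ] → y ≋ z [ n ] → x ≋ z [ n ]
≋-trans {n} {z = z} (q by refl) (r by refl) = (q + r) by lemma z q r (+ n)
  where
  lemma : ∀ z q r n → z + r * n + q * n ≡ z + (q + r) * n
  lemma = solve-∀

≋-weaken : ∀ {m n x y} → m ℕ.∣ n → x ≋ y [ n ] → x ≋ y [ m ]
≋-weaken {m} {_} {_} {y} (ℕ.divides d refl) (q by refl) =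
  (q * + d) by cong (_+_ y) (trans (cong (_*_ q) (ℤ.pos-* d m)) (sym (ℤ.*-assoc q (+ d) (+ m))))

≋-+ : ∀ {n x x′ y y′} → x ≋ x′ [ n ] → y ≋ y′ [ n ] → x + y ≋ x′ + y′ [ n ]
≋-+ {n} {x′ = x} {y′ = y} (q by refl) (r by refl) = (q + r) by lemma x y q r (+ n)
  where
  lemma : ∀ x y q r n → x + q * n + (y + r * n) ≡ x + y + (q + r) * n
  lemma = solve-∀

≋-* : ∀ {n x x′ y y′} → x ≋ x′ [ n ] → y ≋ y′ [ n ] → x * y ≋ x′ * y′ [ n ]
≋-* {n} {x′ = x} {y′ = y} (q by refl) (r by refl) =
  (x * r + q * y + q * r * + n) by lemma x y q r (+ n)
  where
  lemma : ∀ x y q r n → (x + q * n) * (y + r * n) ≡ x * y + (x * r + q * y + q * r * n) * n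
  lemma = solve-∀

≋-*ˡ : ∀ {n x y} c → x ≋ y [ n ] → c * x ≋ c * y [ n ]
≋-*ˡ c = ≋-* {x = c} (≡⇒≋ refl)

≋-- : ∀ {n x x′ y y′} → x ≋ x′ [ n ] → y ≋ y′ [ n ] → x - y ≋ x′ - y′ [ n ]
≋-- {n} {x′ = x} {y′ = y} (q by refl) (r by refl) = (q - r) by lemma x y q r (+ n)
  where
  lemma : ∀ x y q r n → x + q * n - (y + r * n) ≡ x - y + (q - r) * n
  lemma = solve-∀

≋-scale : ∀ c {n x y} → x ≋ y [ n ] → + c * x ≋ + c * y [ c ℕ.* n ]
≋-scale c {n} {_} {y} (q by refl) =
  q by trans (lemma (+ c) y q (+ n)) (cong (λ z → + c * y + q * z) (sym (ℤ.pos-* c n)))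
  where
  lemma : ∀ c y q n → c * (y + q * n) ≡ c * y + q * (c * n)
  lemma = solve-∀

≋-^ : ∀ {n x y} k → x ≋ y [ n ] → x ^ k ≋ y ^ k [ n ]
≋-^ zero    p = ≡⇒≋ refl
≋-^ (suc k) p = ≋-* p (≋-^ k p)

pos-^ : ∀ a n → + (a ℕ.^ n) ≡ (+ a) ^ n
pos-^ a zero    = refl
pos-^ a (suc n) = trans (ℤ.pos-* a (a ℕ.^ n)) (cong (_*_ (+ a)) (pos-^ a n))

alt : ℕ → (ℕ → ℤ) → ℤ
alt zero    f = + 0
alt (suc M) f = f 0 - alt M (λ i → f (suc i))

alt-≋ : ∀ {n} M {f g} → (∀ i → f i ≋ g i [ n ]) → alt M f ≋ alt M g [ n ]
alt-≋ zero    p = ≡⇒≋ refl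
alt-≋ (suc M) p = ≋-- (p 0) (alt-≋ M (λ i → p (suc i)))

alt-cong : ∀ M {f g} → (∀ i → f i ≡ g i) → alt M f ≡ alt M g
alt-cong zero    p = refl
alt-cong (suc M) p = cong₂ _-_ (p 0) (alt-cong M (λ i → p (suc i)))

alt-0 : ∀ M → alt M (λ _ → + 0) ≡ + 0
alt-0 zero    = refl
alt-0 (suc M) = cong (λ z → + 0 - z) (alt-0 M)

alt-+ : ∀ M f g → alt M (λ i → f i + g i) ≡ alt M f + alt M g
alt-+ zero    f g = refl
alt-+ (suc M) f g =
  trans (cong (λ z → f 0 + g 0 - z) (alt-+ M (λ i → f (suc i)) (λ i → g (suc i))))
        (lemma (f 0) (g 0) (alt M (λ i → f (suc i))) (alt M (λ i → g (suc i))))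
  where
  lemma : ∀ a b c d → a + b - (c + d) ≡ (a - c) + (b - d)
  lemma = solve-∀

alt-* : ∀ M c f → alt M (λ i → c * f i) ≡ c * alt M f
alt-* zero    c f = sym (ℤ.*-zeroʳ c)
alt-* (suc M) c f =
  trans (cong (λ z → c * f 0 - z) (alt-* M c (λ i → f (suc i))))
        (lemma c (f 0) (alt M (λ i → f (suc i))))
  where
  lemma : ∀ c a b → c * a - c * b ≡ c * (a - b)
  lemma = solve-∀

-- An odd number of terms precedes the new one, so it enters with a minus sign.
alt-snoc-odd : ∀ p f → alt (suc (suc (p ℕ.* 2))) f ≡ alt (suc (p ℕ.* 2)) f - f (suc (p ℕ.* 2))
alt-snoc-odd zero    f = lemma (f 0) (f 1)
  where
  lemma : ∀ a b → a - (b - + 0) ≡ a - + 0 - b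
  lemma = solve-∀
alt-snoc-odd (suc p) f =
  trans (cong (λ z → f 0 - (f 1 - z)) (alt-snoc-odd p (λ i → f (suc (suc i)))))
        (lemma (f 0) (f 1) (alt (suc (p ℕ.* 2)) (λ i → f (suc (suc i)))) (f (suc (suc p ℕ.* 2))))
  where
  lemma : ∀ a b c d → a - (b - (c - d)) ≡ a - (b - c) - d
  lemma = solve-∀

-- The shift of the index reverses every sign, so all inner terms cancel; the last one comes with a
-- plus because N is odd.
alt-telescope : ∀ p f → let N = suc (p ℕ.* 2) in
                alt N (λ i → f (suc i)) + alt N f ≡ f 0 + f N
alt-telescope p f = lemma (f 0) _ _ _ (alt-snoc-odd p f)
  where
  rearrange : ∀ a b c d → b + c ≡ b - a + (c - d) + (a + d)
  rearrange = solve-∀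
  cancel : ∀ a b c d → b - a + (a - b) + (a + d) ≡ a + d
  cancel = solve-∀
  lemma : ∀ a b c d → a - b ≡ c - d → b + c ≡ a + d
  lemma a b c d eq = trans (rearrange a b c d)
    (trans (cong (λ z → b - a + z + (a + d)) (sym eq)) (cancel a b c d))

-- A block has odd length, so consecutive blocks again carry opposite signs.
alt-blocks : ∀ M f → alt (M ℕ.* 5) f ≡
  alt M (λ j → f (j ℕ.* 5) - f (1 ℕ.+ j ℕ.* 5) + f (2 ℕ.+ j ℕ.* 5) - f (3 ℕ.+ j ℕ.* 5) + f (4 ℕ.+ j ℕ.* 5))
alt-blocks zero    f = refl
alt-blocks (suc M) f =
  trans (cong (λ z → f 0 - (f 1 - (f 2 - (f 3 - (f 4 - z))))) (alt-blocks M (λ i → f (5 ℕ.+ i))))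
        (lemma (f 0) (f 1) (f 2) (f 3) (f 4) _)
  where
  lemma : ∀ a b c d e z → a - (b - (c - (d - (e - z)))) ≡ a - b + c - d + e - z
  lemma = solve-∀

-- S n as an alternating power sum

^≡^ : ∀ x n → x Raw.^ n ≡ x ^ n
^≡^ x zero    = refl
^≡^ x (suc n) = cong (_*_ x) (^≡^ x n)

×≡* : ∀ n x → n Raw.× x ≡ + n * x
×≡* zero    x = sym (ℤ.*-zeroˡ x)
×≡* (suc n) x = trans (cong (_+_ x) (×≡* n x)) (lemma x (+ n))
  where
  lemma : ∀ x n → x + n * x ≡ (+ 1 + n) * x
  lemma = solve-∀

-- Since j < n, one factor 2 splits off from 2^(2n - 2j); this accounts for the exponent in `coeff`
-- and for the halving later on.
4^[n∸j] : ∀ {n j} → j < n → (+ 4) ^ (n ∸ j) ≡ + 2 * (+ 2) ^ (2 ℕ.* n ∸ 2 ℕ.* j ∸ 1)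
4^[n∸j] {n} {j} j<n = begin
  (+ 4) ^ (n ∸ j)                        ≡⟨ ℤ.^-*-assoc (+ 2) 2 (n ∸ j) ⟩
  (+ 2) ^ (2 ℕ.* (n ∸ j))                ≡⟨ cong (_^_ (+ 2)) (ℕ.*-distribˡ-∸ 2 n j) ⟩
  (+ 2) ^ (2 ℕ.* n ∸ 2 ℕ.* j)            ≡⟨ cong (_^_ (+ 2)) (sym (ℕ.m+[n∸m]≡n 1≤)) ⟩
  (+ 2) ^ suc (2 ℕ.* n ∸ 2 ℕ.* j ∸ 1)    ∎
  where
  open ≡-Reasoning
  1≤ : 1 ≤ 2 ℕ.* n ∸ 2 ℕ.* j
  1≤ = ℕ.m<n⇒0<n∸m (ℕ.*-monoʳ-< 2 j<n)

binomial-4 : ∀ x n → (+ 4 + x) ^ n ≡ + 2 * (∑[ j < n ] (coeff n (toℕ j) * x ^ toℕ j)) + x ^ n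
binomial-4 x n = begin
  (+ 4 + x) ^ n
    ≡⟨ cong (λ z → z ^ n) (ℤ.+-comm (+ 4) x) ⟩
  (x + + 4) ^ n
    ≡⟨ ^≡^ (x + + 4) n ⟨
  (x + + 4) Raw.^ n
    ≡⟨ Binomial.theorem n x (+ 4) ⟩
  ∑[ k < suc n ] Binomial.binomialTerm x (+ 4) n k
    ≡⟨ sum-init-last (Binomial.binomialTerm x (+ 4) n) ⟩
  ∑[ k < n ] Binomial.binomialTerm x (+ 4) n (inject₁ k) + Binomial.binomialTerm x (+ 4) n (fromℕ n)
    ≡⟨ cong₂ _+_ (trans (sum-cong-≗ init-term) (sym (*-distribˡ-sum (+ 2) term))) last-term ⟩
  + 2 * (∑[ j < n ] (coeff n (toℕ j) * x ^ toℕ j)) + x ^ n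
    ∎
  where
  open ≡-Reasoning
  term : Fin n → ℤ
  term j = coeff n (toℕ j) * x ^ toℕ j

  expand : ∀ k → Binomial.binomialTerm x (+ 4) n k ≡ + (n C toℕ k) * (x ^ toℕ k * (+ 4) ^ (n ∸ toℕ k))
  expand k = trans (×≡* (n C toℕ k) _)
    (cong₂ (λ y z → + (n C toℕ k) * (y * z)) (^≡^ x (toℕ k)) (^≡^ (+ 4) (n ∸ toℕ k)))

  init-term : ∀ j → Binomial.binomialTerm x (+ 4) n (inject₁ j) ≡ + 2 * term j
  init-term j = trans (expand (inject₁ j))
    (trans (cong (λ i → + (n C i) * (x ^ i * (+ 4) ^ (n ∸ i))) (Fin.toℕ-inject₁ j))
      (trans (cong (λ z → + (n C toℕ j) * (x ^ toℕ j * z)) (4^[n∸j] (Fin.toℕ<n j)))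
        (lemma (+ (n C toℕ j)) (x ^ toℕ j) _)))
    where
    lemma : ∀ c y z → c * (y * (+ 2 * z)) ≡ + 2 * (c * z * y)
    lemma = solve-∀

  last-term : Binomial.binomialTerm x (+ 4) n (fromℕ n) ≡ x ^ n
  last-term = trans (expand (fromℕ n))
    (trans (cong (λ i → + (n C i) * (x ^ i * (+ 4) ^ (n ∸ i))) (Fin.toℕ-fromℕ n))
      (trans (cong₂ (λ i j → + i * (x ^ n * (+ 4) ^ j)) (nCn≡1 n) (ℕ.n∸n≡0 n))
        (lemma (x ^ n))))
    where
    lemma : ∀ y → + 1 * (y * + 1) ≡ y
    lemma = solve-∀

alt-∑ : ∀ M n (c : Fin n → ℤ) (f : Fin n → ℕ → ℤ) →
        alt M (λ i → ∑[ j < n ] (c j * f j i)) ≡ ∑[ j < n ] (c j * alt M (f j))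
alt-∑ M zero    c f = alt-0 M
alt-∑ M (suc n) c f =
  trans (alt-+ M (λ i → c Fin.zero * f Fin.zero i) _)
    (cong₂ _+_ (alt-* M (c Fin.zero) (f Fin.zero))
      (alt-∑ M n (λ j → c (Fin.suc j)) (λ j → f (Fin.suc j))))

∑-≋ : ∀ {N} n {f g : Fin n → ℤ} → (∀ j → f j ≋ g j [ N ]) →
      (∑[ j < n ] f j) ≋ (∑[ j < n ] g j) [ N ]
∑-≋ zero    p = ≡⇒≋ refl
∑-≋ (suc n) p = ≋-+ (p Fin.zero) (∑-≋ n (λ j → p (Fin.suc j)))

-- The progression 4i + 1, given recursively so that the shift by 4 to which `binomial-4` applies
-- holds by computation.
X : ℕ → ℤ
X zero    = + 1
X (suc i) = + 4 + X i

X-closed : ∀ i → X i ≡ + 1 + + 4 * + i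
X-closed zero    = refl
X-closed (suc i) = trans (cong (_+_ (+ 4)) (X-closed i)) (lemma (+ i))
  where
  lemma : ∀ i → + 4 + (+ 1 + + 4 * i) ≡ + 1 + + 4 * (+ 1 + i)
  lemma = solve-∀

A : ℕ → ℕ → ℤ
A N n = alt N (λ i → X i ^ n)

-- The alternating sums telescope because X (suc i) = 4 + X i.
A-recurrence : ∀ p n → let N = suc (p ℕ.* 2) in
  + 2 * A N n ≡ + 1 + X N ^ n - + 2 * (∑[ j < n ] (coeff n (toℕ j) * A N (toℕ j)))
A-recurrence p n = solve-for-A (∑[ j < n ] (coeff n (toℕ j) * A N (toℕ j))) (A N n) (+ 1) (X N ^ n) (begin
  + 2 * (∑[ j < n ] (coeff n (toℕ j) * A N (toℕ j))) + A N n + A N n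
    ≡⟨ cong (λ z → + 2 * z + A N n + A N n)
         (alt-∑ N n (λ j → coeff n (toℕ j)) (λ j i → X i ^ toℕ j)) ⟨
  + 2 * alt N lower + A N n + A N n
    ≡⟨ cong (λ z → z + A N n + A N n) (alt-* N (+ 2) lower) ⟨
  alt N (λ i → + 2 * lower i) + A N n + A N n
    ≡⟨ cong (λ z → z + A N n) (alt-+ N (λ i → + 2 * lower i) (λ i → X i ^ n)) ⟨
  alt N (λ i → + 2 * lower i + X i ^ n) + A N n
    ≡⟨ cong (λ z → z + A N n) (alt-cong N (λ i → binomial-4 (X i) n)) ⟨
  alt N (λ i → X (suc i) ^ n) + A N n
    ≡⟨ alt-telescope p (λ i → X i ^ n) ⟩
  (+ 1) ^ n + X N ^ n
    ≡⟨ cong (λ z → z + X N ^ n) (ℤ.^-zeroˡ n) ⟩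
  + 1 + X N ^ n ∎)
  where
  open ≡-Reasoning
  N : ℕ
  N = suc (p ℕ.* 2)
  lower : ℕ → ℤ
  lower i = ∑[ j < n ] (coeff n (toℕ j) * X i ^ toℕ j)
  lemma : ∀ s a → + 2 * a ≡ + 2 * s + a + a - + 2 * s
  lemma = solve-∀
  solve-for-A : ∀ s a t u → + 2 * s + a + a ≡ t + u → + 2 * a ≡ t + u - + 2 * s
  solve-for-A s a t u eq = trans (lemma s a) (cong (λ z → z - + 2 * s) eq)

-- The inverse of 2 modulo 2p + 1 is p + 1.
≋-halve : ∀ p {x y} → let N = suc (p ℕ.* 2) in + 2 * x ≋ + 2 * y [ N ] → x ≋ y [ N ]
≋-halve p {x} {y} eq = ≋-trans (≋-sym (inverse x)) (≋-trans (≋-*ˡ (+ suc p) eq) (inverse y))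
  where
  lemma : ∀ p z → (+ 1 + p) * (+ 2 * z) ≡ z + z * (+ 1 + p * + 2)
  lemma = solve-∀
  inverse : ∀ z → + suc p * (+ 2 * z) ≋ z [ suc (p ℕ.* 2) ]
  inverse z = z by trans (lemma (+ p) z)
    (cong (λ n → z + z * (+ 1 + n)) (sym (ℤ.pos-* p 2)))

X-N : ∀ N → X N ≋ + 1 [ N ]
X-N N = + 4 by X-closed N

-- As `X N` = 4N + 1 ≡ 1, the boundary terms of `A-recurrence` add up to 2, and halving leaves the
-- recurrence of `S`.
S≋A : ∀ p n → let N = suc (p ℕ.* 2) in S n ≋ A N n [ N ]
S≋A p = <-rec _ step
  where
  N : ℕ
  N = suc (p ℕ.* 2)

  A-mod : ∀ n → + 2 * A N n ≋ + 2 * (+ 1 - (∑[ j < n ] (coeff n (toℕ j) * A N (toℕ j)))) [ N ]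
  A-mod n = ≋-trans (≡⇒≋ (A-recurrence p n))
    (≋-trans (≋-- (≋-+ (≡⇒≋ {x = + 1} refl) (≋-trans (≋-^ n (X-N N)) (≡⇒≋ (ℤ.^-zeroˡ n)))) (≡⇒≋ refl))
      (≡⇒≋ (lemma (∑[ j < n ] (coeff n (toℕ j) * A N (toℕ j))))))
    where
    lemma : ∀ s → + 1 + + 1 - + 2 * s ≡ + 2 * (+ 1 - s)
    lemma = solve-∀

  step : ∀ n → (∀ {j} → j < n → S j ≋ A N j [ N ]) → S n ≋ A N n [ N ]
  step zero    _  = ≋-sym (≋-halve p (A-mod 0))
  step (suc n) ih = ≋-trans (≡⇒≋ (S-suc n))
    (≋-trans (≋-- (≡⇒≋ {x = + 1} refl)
               (∑-≋ (suc n) (λ j → ≋-*ˡ (coeff (suc n) (toℕ j)) (ih (Fin.toℕ<n j)))))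
      (≋-sym (≋-halve p (A-mod (suc n)))))

-- Restriction to the terms prime to 5

-- By Fermat this means that 5 does not divide x; in this form the quotient of the congruence is the
-- v with x⁴ = 1 + 5v.
Unit : ℤ → Set
Unit x = x ^ 4 ≋ + 1 [ 5 ]

-- The multiples of 5 in the progression are 5 times the progression itself, which is why S n
-- reappears with the factor 5ⁿ.
X-block : ∀ j → X (1 ℕ.+ j ℕ.* 5) ≡ + 5 * X j
X-block j = trans (X-closed (1 ℕ.+ j ℕ.* 5))
  (trans (cong (λ z → + 1 + + 4 * (+ 1 + z)) (ℤ.pos-* j 5))
    (trans (lemma (+ j)) (cong (_*_ (+ 5)) (sym (X-closed j)))))
  where
  lemma : ∀ j → + 1 + + 4 * (+ 1 + j * + 5) ≡ + 5 * (+ 1 + + 4 * j)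
  lemma = solve-∀

X-unit : ∀ s {q} → X s ^ 4 ≡ + 1 + q * + 5 → ∀ j → Unit (X (s ℕ.+ j ℕ.* 5))
X-unit s {q} eq j = ≋-trans (≋-^ {y = X s} 4 ((+ 4 * + j) by trans (X-closed (s ℕ.+ j ℕ.* 5))
  (trans (cong (λ z → + 1 + + 4 * (+ s + z)) (ℤ.pos-* j 5))
    (trans (lemma (+ s) (+ j)) (cong (_+ + 4 * + j * + 5) (sym (X-closed s)))))))
  (q by eq)
  where
  lemma : ∀ s j → + 1 + + 4 * (s + j * + 5) ≡ + 1 + + 4 * s + + 4 * j * + 5
  lemma = solve-∀

-- Position 1 of each block of five holds the multiple of 5; the other positions keep their
-- alternating signs.
block : (ℤ → ℤ) → ℕ → ℤ
block f j = f (X (j ℕ.* 5)) + f (X (2 ℕ.+ j ℕ.* 5)) - f (X (3 ℕ.+ j ℕ.* 5)) + f (X (4 ℕ.+ j ℕ.* 5))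

-- The alternating sum of f (X i) over those i < 5M for which 5 does not divide X i.
I : ℕ → (ℤ → ℤ) → ℤ
I M f = alt M (block f)

I-≋ : ∀ {n} M {f g} → (∀ x → Unit x → f x ≋ g x [ n ]) → I M f ≋ I M g [ n ]
I-≋ M p = alt-≋ M (λ j →
  -- The numerals are (x⁴ - 1) / 5 for x = 1, 9, 13, 17.
  ≋-+ (≋-- (≋-+ (p _ (X-unit 0 {+ 0} refl j)) (p _ (X-unit 2 {+ 1312} refl j)))
           (p _ (X-unit 3 {+ 5712} refl j)))
      (p _ (X-unit 4 {+ 16704} refl j)))

I-cong : ∀ M {f g} → (∀ x → f x ≡ g x) → I M f ≡ I M g
I-cong M p = alt-cong M (λ j →
  cong₂ _+_ (cong₂ _-_ (cong₂ _+_ (p _) (p _)) (p _)) (p _))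

I-+ : ∀ M f g → I M (λ x → f x + g x) ≡ I M f + I M g
I-+ M f g = trans (alt-cong M (λ j → lemma (f _) (f _) (f _) (f _) (g _) (g _) (g _) (g _)))
                  (alt-+ M (block f) (block g))
  where
  lemma : ∀ a b c d a′ b′ c′ d′ → (a + a′) + (b + b′) - (c + c′) + (d + d′) ≡
          (a + b - c + d) + (a′ + b′ - c′ + d′)
  lemma = solve-∀

I-* : ∀ M c f → I M (λ x → c * f x) ≡ c * I M f
I-* M c f = trans (alt-cong M (λ j → lemma c (f _) (f _) (f _) (f _))) (alt-* M c (block f))
  where
  lemma : ∀ k a b c d → k * a + k * b - k * c + k * d ≡ k * (a + b - c + d)
  lemma = solve-∀

I-0 : ∀ M → I M (λ _ → + 0) ≡ + 0
I-0 M = trans (I-* M (+ 0) (λ _ → + 0)) (ℤ.*-zeroˡ (I M (λ _ → + 0)))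

U : ℕ → ℕ → ℤ
U M n = I M (λ x → x ^ n)

A-split : ∀ M n → A (M ℕ.* 5) n ≡ U M n - (+ 5) ^ n * A M n
A-split M n = begin
  alt (M ℕ.* 5) (λ i → X i ^ n)
    ≡⟨ alt-blocks M (λ i → X i ^ n) ⟩
  alt M (λ j → X (j ℕ.* 5) ^ n - X (1 ℕ.+ j ℕ.* 5) ^ n + X (2 ℕ.+ j ℕ.* 5) ^ n
               - X (3 ℕ.+ j ℕ.* 5) ^ n + X (4 ℕ.+ j ℕ.* 5) ^ n)
    ≡⟨ alt-cong M (λ j → trans (lemma (X (j ℕ.* 5) ^ n) _ _ _ _)
         (cong (λ z → block (λ x → x ^ n) j + - (+ 1) * z) (power j))) ⟩
  alt M (λ j → block (λ x → x ^ n) j + - (+ 1) * ((+ 5) ^ n * X j ^ n))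
    ≡⟨ alt-+ M (block (λ x → x ^ n)) (λ j → - (+ 1) * ((+ 5) ^ n * X j ^ n)) ⟩
  U M n + alt M (λ j → - (+ 1) * ((+ 5) ^ n * X j ^ n))
    ≡⟨ cong (_+_ (U M n)) (trans (alt-* M (- (+ 1)) (λ j → (+ 5) ^ n * X j ^ n))
         (cong (_*_ (- (+ 1))) (alt-* M ((+ 5) ^ n) (λ j → X j ^ n)))) ⟩
  U M n + - (+ 1) * ((+ 5) ^ n * A M n)
    ≡⟨ lemma′ (U M n) ((+ 5) ^ n * A M n) ⟩
  U M n - (+ 5) ^ n * A M n ∎
  where
  open ≡-Reasoning
  lemma : ∀ a b c d e → a - b + c - d + e ≡ a + c - d + e + - (+ 1) * b
  lemma = solve-∀
  lemma′ : ∀ a b → a + - (+ 1) * b ≡ a - b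
  lemma′ = solve-∀
  *-^ : ∀ x y n → (x * y) ^ n ≡ x ^ n * y ^ n
  *-^ x y zero    = refl
  *-^ x y (suc n) = trans (cong (_*_ (x * y)) (*-^ x y n)) (swap x y (x ^ n) (y ^ n))
    where
    swap : ∀ x y z w → x * y * (z * w) ≡ x * z * (y * w)
    swap = solve-∀
  power : ∀ j → X (1 ℕ.+ j ℕ.* 5) ^ n ≡ (+ 5) ^ n * X j ^ n
  power j = trans (cong (λ x → x ^ n) (X-block j)) (*-^ (+ 5) (X j) n)

Odd : ℕ → Set
Odd n = ∃ λ p → n ≡ suc (p ℕ.* 2)

odd-*5 : ∀ {n} → Odd n → Odd (n ℕ.* 5)
odd-*5 (p , refl) = 2 ℕ.+ p ℕ.* 5 , cong (5 ℕ.+_) (lemma p)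
  where
  lemma : ∀ p → p ℕ.* 2 ℕ.* 5 ≡ p ℕ.* 5 ℕ.* 2
  lemma = ℕ-solve-∀

S≋A-odd : ∀ {N} → Odd N → ∀ n → S n ≋ A N n [ N ]
S≋A-odd (p , refl) = S≋A p

-- The sum over 5M terms is known modulo 5M, but `A M n` only modulo M. The modulus L stays open
-- because the outcome depends on how far 5ⁿ makes up for this.
U≋S : ∀ {M L} → Odd M → L ℕ.∣ M ℕ.* 5 → ∀ n →
      (+ 5) ^ n * A M n ≋ (+ 5) ^ n * S n [ L ] → U M n ≋ (+ 1 + (+ 5) ^ n) * S n [ L ]
U≋S {M} odd L∣5M n p =
  ≋-trans (≡⇒≋ (solve-for-U (A (M ℕ.* 5) n) (U M n) ((+ 5) ^ n * A M n) (A-split M n)))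
    (≋-trans (≋-+ (≋-sym (≋-weaken L∣5M (S≋A-odd (odd-*5 odd) n))) p)
      (≡⇒≋ (factor ((+ 5) ^ n) (S n))))
  where
  cancel : ∀ u b → u - b + b ≡ u
  cancel = solve-∀
  solve-for-U : ∀ a u b → a ≡ u - b → u ≡ a + b
  solve-for-U a u b eq = trans (sym (cancel u b)) (cong (_+ b) (sym eq))
  factor : ∀ c s → s + c * s ≡ (+ 1 + c) * s
  factor = solve-∀

U≋S-weak : ∀ {M} → Odd M → ∀ n → U M n ≋ (+ 1 + (+ 5) ^ n) * S n [ M ]
U≋S-weak {M} odd n = U≋S odd (ℕ.m∣m*n 5) n (≋-*ˡ ((+ 5) ^ n) (≋-sym (S≋A-odd odd n)))

-- One factor 5 of `(+ 5) ^ suc n` lifts the congruence for `A M` from M to 5M.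
U≋S-suc : ∀ {M} → Odd M → ∀ n → U M (suc n) ≋ (+ 1 + (+ 5) ^ suc n) * S (suc n) [ 5 ℕ.* M ]
U≋S-suc {M} odd n = U≋S odd (ℕ.∣-reflexive (ℕ.*-comm 5 M)) (suc n)
  (≋-trans (≡⇒≋ (ℤ.*-assoc (+ 5) ((+ 5) ^ n) (A M (suc n))))
    (≋-trans (≋-scale 5 (≋-*ˡ ((+ 5) ^ n) (≋-sym (S≋A-odd odd (suc n)))))
      (≡⇒≋ (sym (ℤ.*-assoc (+ 5) ((+ 5) ^ n) (S (suc n)))))))

-- The logarithm of y = 1 + 5v

-- The higher binomial terms are collected behind the factor 5a, so that they vanish visibly once 5⁵
-- divides 5a.
step : ℤ → ℤ → ℤ
step a d = d + + 5 * a * (+ 2 * (d * d) + + 10 * a * (d * d * d)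
             + + 25 * a * a * (d * d * d * d) + + 25 * a * a * a * (d * d * d * d * d))

fifth-power : ∀ a d → (+ 1 + + 5 * a * d) ^ 5 ≡ + 1 + + 5 * (+ 5 * a) * step a d
fifth-power = lemma
  where
  lemma : ∀ a d → let y = + 1 + + 5 * a * d in y * (y * (y * (y * (y * + 1)))) ≡
    + 1 + + 5 * (+ 5 * a) * (d + + 5 * a * (+ 2 * (d * d) + + 10 * a * (d * d * d)
      + + 25 * a * a * (d * d * d * d) + + 25 * a * a * a * (d * d * d * d * d)))
  lemma = solve-∀

-- This is ((1 + 5v)^(5ⁿ) - 1) / 5^(n+1), without a division; it tends 5-adically to log (1 + 5v) /
-- 5.
quot : ℤ → ℕ → ℤ
quot v zero    = v
quot v (suc n) = step ((+ 5) ^ n) (quot v n)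

5^-power : ∀ v n → (+ 1 + v * + 5) ^ (5 ℕ.^ n) ≡ + 1 + + 5 * (+ 5) ^ n * quot v n
5^-power v zero    = lemma v
  where
  lemma : ∀ v → (+ 1 + v * + 5) * + 1 ≡ + 1 + + 5 * + 1 * v
  lemma = solve-∀
5^-power v (suc n) = begin
  y ^ (5 ℕ.* 5 ℕ.^ n)                             ≡⟨ cong (_^_ y) (ℕ.*-comm 5 (5 ℕ.^ n)) ⟩
  y ^ (5 ℕ.^ n ℕ.* 5)                             ≡⟨ ℤ.^-*-assoc y (5 ℕ.^ n) 5 ⟨
  (y ^ (5 ℕ.^ n)) ^ 5                             ≡⟨ cong (λ z → z ^ 5) (5^-power v n) ⟩
  (+ 1 + + 5 * (+ 5) ^ n * quot v n) ^ 5          ≡⟨ fifth-power ((+ 5) ^ n) (quot v n) ⟩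
  + 1 + + 5 * (+ 5) ^ suc n * quot v (suc n)      ∎
  where
  open ≡-Reasoning
  y : ℤ
  y = + 1 + v * + 5

-- log (1 + 5v) / 5 modulo 5⁵, with 1560 ≡ - 5/2, 1050 ≡ 25/3 and 750 ≡ - 125/4.
ℓ : ℤ → ℤ
ℓ v = v + + 1560 * (v * v) + + 1050 * (v * v * v) + + 750 * (v * v * v * v) + + 125 * (v * v * v * v * v)

step-1 : ∀ v → step (+ 1) v ≡ v + + 10 * (v * v) + + 50 * (v * v * v)
                              + + 125 * (v * v * v * v) + + 125 * (v * v * v * v * v)
step-1 = lemma
  where
  lemma : ∀ v → v + + 5 * + 1 * (+ 2 * (v * v) + + 10 * + 1 * (v * v * v)
             + + 25 * + 1 * + 1 * (v * v * v * v) + + 25 * + 1 * + 1 * + 1 * (v * v * v * v * v))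
          ≡ v + + 10 * (v * v) + + 50 * (v * v * v) + + 125 * (v * v * v * v) + + 125 * (v * v * v * v * v)
  lemma = solve-∀

-- The modulus 3125 appears as 25a³ for a = 5, and in the two following lemmas as 5a² for a = 25 and
-- as 25a for a = 125.
step-5 : ∀ d → step (+ 5) d ≋ d + + 50 * (d * d) + + 1250 * (d * d * d) [ 3125 ]
step-5 d = (+ 5 * (d * d * d * d) + + 5 * + 5 * (d * d * d * d * d)) by lemma (+ 5) d
  where
  lemma : ∀ a d → d + + 5 * a * (+ 2 * (d * d) + + 10 * a * (d * d * d)
             + + 25 * a * a * (d * d * d * d) + + 25 * a * a * a * (d * d * d * d * d))
          ≡ d + + 10 * a * (d * d) + + 50 * a * a * (d * d * d)
            + (+ 5 * (d * d * d * d) + + 5 * a * (d * d * d * d * d)) * (+ 25 * a * a * a)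
  lemma = solve-∀

step-25 : ∀ d → step (+ 25) d ≋ d + + 250 * (d * d) [ 3125 ]
step-25 d = (+ 10 * (d * d * d) + + 25 * + 25 * (d * d * d * d) + + 25 * + 25 * + 25 * (d * d * d * d * d))
  by lemma (+ 25) d
  where
  lemma : ∀ a d → d + + 5 * a * (+ 2 * (d * d) + + 10 * a * (d * d * d)
             + + 25 * a * a * (d * d * d * d) + + 25 * a * a * a * (d * d * d * d * d))
          ≡ d + + 10 * a * (d * d)
            + (+ 10 * (d * d * d) + + 25 * a * (d * d * d * d) + + 25 * a * a * (d * d * d * d * d)) * (+ 5 * a * a)
  lemma = solve-∀

step-125 : ∀ d → step (+ 125) d ≋ d + + 1250 * (d * d) [ 3125 ]
step-125 d = (+ 2 * + 125 * (d * d * d) + + 5 * + 125 * + 125 * (d * d * d * d)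
              + + 5 * + 125 * + 125 * + 125 * (d * d * d * d * d)) by lemma (+ 125) d
  where
  lemma : ∀ a d → d + + 5 * a * (+ 2 * (d * d) + + 10 * a * (d * d * d)
             + + 25 * a * a * (d * d * d * d) + + 25 * a * a * a * (d * d * d * d * d))
          ≡ d + + 10 * a * (d * d)
            + (+ 2 * a * (d * d * d) + + 5 * a * a * (d * d * d * d)
               + + 5 * a * a * a * (d * d * d * d * d)) * (+ 25 * a)
  lemma = solve-∀

step-625 : ∀ p a d → + 5 * a ≡ p * + 3125 → step a d ≋ d [ 3125 ]
step-625 p a d eq = (p * t) by trans (cong (λ z → d + z * t) eq) (cong (_+_ d) (lemma p t (+ 3125)))
  where
  t : ℤ
  t = + 2 * (d * d) + + 10 * a * (d * d * d)
      + + 25 * a * a * (d * d * d * d) + + 25 * a * a * a * (d * d * d * d * d)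
  lemma : ∀ p t c → p * c * t ≡ p * t * c
  lemma = solve-∀

-- A coefficient c divisible by a power of 5 lowers the precision to which its companion x has to be
-- known.
≋-+-scale : ∀ c n {m d w} (x y : ℤ) → m ℕ.∣ c ℕ.* n → d ≋ w [ m ] → x ≋ y [ n ] →
            d + + c * x ≋ w + + c * y [ m ]
≋-+-scale c n x y m∣cn p q = ≋-+ p (≋-weaken m∣cn (≋-scale c q))

≋-square : ∀ {n x y} → x ≋ y [ n ] → x * x ≋ y * y [ n ]
≋-square {_} {x} {y} p = ≋-* {x = x} {y} {x} {y} p p

module _ (v : ℤ) where

  -- The residues of quot v 1, quot v 2 and quot v 3 modulo 5⁵.
  w₁ w₂ w₃ : ℤ
  w₁ = v + + 10 * (v * v) + + 50 * (v * v * v) + + 125 * (v * v * v * v) + + 125 * (v * v * v * v * v)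
  w₂ = v + + 60 * (v * v) + + 2300 * (v * v * v) + + 750 * (v * v * v * v) + + 125 * (v * v * v * v * v)
  w₃ = v + + 310 * (v * v) + + 1050 * (v * v * v) + + 750 * (v * v * v * v) + + 125 * (v * v * v * v * v)

  w₁≋ : w₁ ≋ v + + 10 * (v * v) + + 50 * (v * v * v) [ 125 ]
  w₁≋ = (v * v * v * v + v * v * v * v * v) by lemma v
    where
    lemma : ∀ v → v + + 10 * (v * v) + + 50 * (v * v * v) + + 125 * (v * v * v * v) + + 125 * (v * v * v * v * v)
      ≡ v + + 10 * (v * v) + + 50 * (v * v * v) + (v * v * v * v + v * v * v * v * v) * + 125
    lemma = solve-∀

  w₁² : w₁ * w₁ ≋ v * v + + 20 * (v * v * v) + + 75 * (v * v * v * v) [ 125 ]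
  w₁² = ≋-trans (≋-square w₁≋)
    ((v * v * v * v + + 8 * (v * v * v * v * v) + + 20 * (v * v * v * v * v * v)) by lemma v)
    where
    lemma : ∀ v → (v + + 10 * (v * v) + + 50 * (v * v * v)) * (v + + 10 * (v * v) + + 50 * (v * v * v))
      ≡ v * v + + 20 * (v * v * v) + + 75 * (v * v * v * v)
        + (v * v * v * v + + 8 * (v * v * v * v * v) + + 20 * (v * v * v * v * v * v)) * + 125
    lemma = solve-∀

  -- Used with the coefficients of `w₁` and `w₃` divided by 5: the terms beyond v all vanish modulo
  -- 5.
  ≋v : ∀ b c d e → v + + 5 * b * (v * v) + + 5 * c * (v * v * v) + + 5 * d * (v * v * v * v)
                     + + 5 * e * (v * v * v * v * v) ≋ v [ 5 ]
  ≋v b c d e = (b * (v * v) + c * (v * v * v) + d * (v * v * v * v) + e * (v * v * v * v * v)) by lemma v b c d e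
    where
    lemma : ∀ v b c d e → v + + 5 * b * (v * v) + + 5 * c * (v * v * v) + + 5 * d * (v * v * v * v)
      + + 5 * e * (v * v * v * v * v)
      ≡ v + (b * (v * v) + c * (v * v * v) + d * (v * v * v * v) + e * (v * v * v * v * v)) * + 5
    lemma = solve-∀

  step-5-w₁ : ∀ {d} → d ≋ w₁ [ 3125 ] → step (+ 5) d ≋ w₂ [ 3125 ]
  step-5-w₁ {d} p = ≋-trans (step-5 d)
    (≋-trans (≋-+-scale 1250 5 (d * d * d) (v * v * v) (ℕ.divides 2 refl)
                (≋-+-scale 50 125 (d * d) (v * v + + 20 * (v * v * v) + + 75 * (v * v * v * v)) (ℕ.divides 2 refl) p
                  (≋-trans (≋-square (≋-weaken (ℕ.divides 25 refl) p)) w₁²))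
                (≋-* {x = d * d} {v * v} {d} {v} (≋-square p′) p′))
      ((v * v * v * v) by lemma v (+ 5)))
    where
    p′ : d ≋ v [ 5 ]
    p′ = ≋-trans (≋-weaken (ℕ.divides 625 refl) p) (≋v (+ 2) (+ 10) (+ 25) (+ 25))
    lemma : ∀ v c →
      v + + 2 * c * (v * v) + + 10 * c * (v * v * v) + + 25 * c * (v * v * v * v) + + 25 * c * (v * v * v * v * v)
      + + 10 * c * (v * v + + 20 * (v * v * v) + + 75 * (v * v * v * v)) + + 250 * c * (v * v * v)
      ≡ v + + 12 * c * (v * v) + + 460 * c * (v * v * v) + + 150 * c * (v * v * v * v) + + 25 * c * (v * v * v * v * v)
        + (v * v * v * v) * (+ 625 * c)
    lemma = solve-∀

  w₂≋ : w₂ ≋ v + + 10 * (v * v) [ 25 ]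
  w₂≋ = (+ 2 * (v * v) + + 92 * (v * v * v) + + 30 * (v * v * v * v) + + 5 * (v * v * v * v * v)) by lemma v (+ 25)
    where
    lemma : ∀ v c →
      v + (+ 10 + + 2 * c) * (v * v) + + 92 * c * (v * v * v) + + 30 * c * (v * v * v * v) + + 5 * c * (v * v * v * v * v)
      ≡ v + + 10 * (v * v) + (+ 2 * (v * v) + + 92 * (v * v * v) + + 30 * (v * v * v * v) + + 5 * (v * v * v * v * v)) * c
    lemma = solve-∀

  w₂² : w₂ * w₂ ≋ v * v + + 20 * (v * v * v) [ 25 ]
  w₂² = ≋-trans (≋-square w₂≋) ((+ 4 * (v * v * v * v)) by lemma v)
    where
    lemma : ∀ v → (v + + 10 * (v * v)) * (v + + 10 * (v * v)) ≡ v * v + + 20 * (v * v * v) + (+ 4 * (v * v * v * v)) * + 25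
    lemma = solve-∀

  step-25-w₂ : ∀ {d} → d ≋ w₂ [ 3125 ] → step (+ 25) d ≋ w₃ [ 3125 ]
  step-25-w₂ {d} p = ≋-trans (step-25 d)
    (≋-trans (≋-+-scale 250 25 (d * d) (v * v + + 20 * (v * v * v)) (ℕ.divides 2 refl) p
                (≋-trans (≋-square (≋-weaken (ℕ.divides 125 refl) p)) w₂²))
      ((+ 2 * (v * v * v)) by lemma v (+ 10) (+ 25)))
    where
    lemma : ∀ v b c →
      v + + 6 * b * (v * v) + + 92 * c * (v * v * v) + + 30 * c * (v * v * v * v) + + 5 * c * (v * v * v * v * v)
      + b * c * (v * v + + 2 * b * (v * v * v))
      ≡ v + (+ 6 * b + b * c) * (v * v) + (+ 92 * c + + 2 * b * b * c + - + 250 * c) * (v * v * v)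
        + + 30 * c * (v * v * v * v) + + 5 * c * (v * v * v * v * v)
        + (+ 2 * (v * v * v)) * (+ 125 * c)
    lemma = solve-∀

  step-125-w₃ : ∀ {d} → d ≋ w₃ [ 3125 ] → step (+ 125) d ≋ ℓ v [ 3125 ]
  step-125-w₃ {d} p = ≋-trans (step-125 d)
    (≋-trans (≋-+-scale 1250 5 (d * d) (v * v) (ℕ.divides 2 refl) p
                (≋-square (≋-trans (≋-weaken (ℕ.divides 625 refl) p) (≋v (+ 62) (+ 210) (+ 150) (+ 25)))))
      (≡⇒≋ (lemma v (v * v) (+ 1050 * (v * v * v)) (+ 750 * (v * v * v * v))
                  (+ 125 * (v * v * v * v * v)) (+ 310) (+ 1250))))
    where
    lemma : ∀ v w x y z b c → v + b * w + x + y + z + c * w ≡ v + (b + c) * w + x + y + z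
    lemma = solve-∀

quot-suc : ∀ v n {a} → (+ 5) ^ n ≡ a → quot v (suc n) ≡ step a (quot v n)
quot-suc v n refl = refl

-- Four fifth powers build up the logarithm modulo 5⁵, and by `step-625` the later ones change
-- nothing.
quot≋ℓ : ∀ v s → quot v (4 ℕ.+ s) ≋ ℓ v [ 3125 ]
quot≋ℓ v zero    = quot-4
  where
  quot-1 : quot v 1 ≋ w₁ v [ 3125 ]
  quot-1 = ≋-trans (≡⇒≋ (quot-suc v 0 {+ 1} refl)) (≡⇒≋ (step-1 v))
  quot-2 : quot v 2 ≋ w₂ v [ 3125 ]
  quot-2 = ≋-trans (≡⇒≋ (quot-suc v 1 {+ 5} refl)) (step-5-w₁ v {quot v 1} quot-1)
  quot-3 : quot v 3 ≋ w₃ v [ 3125 ]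
  quot-3 = ≋-trans (≡⇒≋ (quot-suc v 2 {+ 25} refl)) (step-25-w₂ v {quot v 2} quot-2)
  quot-4 : quot v 4 ≋ ℓ v [ 3125 ]
  quot-4 = ≋-trans (≡⇒≋ (quot-suc v 3 {+ 125} refl)) (step-125-w₃ v {quot v 3} quot-3)
quot≋ℓ v (suc s) = ≋-trans (≡⇒≋ (quot-suc v (4 ℕ.+ s) refl))
  (≋-trans (step-625 ((+ 5) ^ s) ((+ 5) ^ (4 ℕ.+ s)) (quot v (4 ℕ.+ s)) (lemma ((+ 5) ^ s))) (quot≋ℓ v s))
  where
  lemma : ∀ p → + 5 * (+ 5 * (+ 5 * (+ 5 * (+ 5 * p)))) ≡ p * + 3125
  lemma = solve-∀

quintic : (a b c d e f x : ℤ) → ℤ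
quintic a b c d e f x = a + x * (b + x * (c + x * (d + x * (e + x * f))))

-- 5 log y modulo 5⁷ at y = 1 + 5v, in powers of y; the factor 5 clears the denominator of (y − 1)⁵ / 5.
h : ℤ → ℤ
h = quintic (+ 1374) (- + 2600) (+ 1100) (+ 100) (+ 25) (+ 1)

h-ℓ : ∀ v → h (+ 1 + v * + 5) ≡ + 25 * ℓ v
h-ℓ v = trans (expand (v * + 5)) (factor v (+ 5))
  where
  -- These are the coefficients 5, -5/2, 5/3, -5/4, 1 of 5 log (1 + u): 1560, 210 and 30 represent
  -- the fractions modulo 5⁵, 5⁴ and 5³, since u² , u³ and u⁴ supply the rest of 5⁷. From u⁶ on
  -- everything vanishes modulo 5⁷.
  expand : ∀ u → let y = + 1 + u in
    + 1374 + y * (- + 2600 + y * (+ 1100 + y * (+ 100 + y * (+ 25 + y * + 1))))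
    ≡ + 5 * u + + 1560 * (u * u) + + 210 * (u * u * u) + + 30 * (u * u * u * u) + u * u * u * u * u
  expand = solve-∀
  factor : ∀ v c → let u = v * c in
    c * u + + 1560 * (u * u) + + 210 * (u * u * u) + + 30 * (u * u * u * u) + u * u * u * u * u
    ≡ c * c * (v + + 1560 * (v * v) + + 210 * c * (v * v * v) + + 30 * c * c * (v * v * v * v)
               + c * c * c * (v * v * v * v * v))
  factor = solve-∀

-- Powers of y to first order in 5^m

^-first-order : ∀ q k → ∃ λ e → (+ 1 + q) ^ k ≡ + 1 + + k * q + q * q * e
^-first-order q zero    = + 0 , lemma q
  where
  lemma : ∀ q → + 1 ≡ + 1 + + 0 * q + q * q * + 0
  lemma = solve-∀
^-first-order q (suc k) = (+ k + e + q * e) , trans (cong (_*_ (+ 1 + q)) eq) (lemma q (+ k) e)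
  where
  e : ℤ
  e = proj₁ (^-first-order q k)
  eq : (+ 1 + q) ^ k ≡ + 1 + + k * q + q * q * e
  eq = proj₂ (^-first-order q k)
  lemma : ∀ q k e → (+ 1 + q) * (+ 1 + k * q + q * q * e) ≡ + 1 + (+ 1 + k) * q + q * q * (k + e + q * e)
  lemma = solve-∀

-- With n = 5¹⁰ p, both the square of q = 5⁵ p and q times an error divisible by 5⁵ are multiples of
-- n. The factor 5⁵ is written as 125 · 25 to expose 25 ℓ, which is `h`.
^-first-order-mod : ∀ {n} p q d l k → q ≡ p * + 3125 → d ≋ l [ 3125 ] → + n ≡ + 9765625 * p →
                    (+ 1 + q * d) ^ k ≋ + 1 + + 125 * p * + k * (+ 25 * l) [ n ]
^-first-order-mod {n} p _ d l k refl (e by d≡) n≡ = (+ k * e + p * d * d * f) by (begin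
  (+ 1 + q * d) ^ k
    ≡⟨ proj₂ (^-first-order (q * d) k) ⟩
  + 1 + + k * (q * d) + q * d * (q * d) * f
    ≡⟨ cong (λ z → + 1 + + k * (q * z) + q * d * (q * d) * f) d≡ ⟩
  + 1 + + k * (q * (l + e * + 3125)) + q * d * (q * d) * f
    ≡⟨ lemma (+ k) p (+ 125) (+ 25) l e d f ⟩
  + 1 + + 125 * p * + k * (+ 25 * l) + (+ k * e + p * d * d * f) * (+ 9765625 * p)
    ≡⟨ cong (λ z → + 1 + + 125 * p * + k * (+ 25 * l) + (+ k * e + p * d * d * f) * z) n≡ ⟨
  + 1 + + 125 * p * + k * (+ 25 * l) + (+ k * e + p * d * d * f) * + n ∎)
  where
  open ≡-Reasoning
  q f : ℤ
  q = p * + 3125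
  f = proj₁ (^-first-order (q * d) k)
  lemma : ∀ k p b c l e d f → let q = p * (b * c) in
    + 1 + k * (q * (l + e * (b * c))) + q * d * (q * d) * f
    ≡ + 1 + b * p * k * (c * l) + (k * e + p * d * d * f) * (b * c * (b * c) * p)
  lemma = solve-∀

-- Here m = 5 + s. The visible factor is 5^(3+s) and not 5^(m-1), because `h` carries one more
-- factor 5 than the logarithm.
power≋h : ∀ v s k → let y = + 1 + v * + 5 in
  y ^ (5 ℕ.^ (4 ℕ.+ s) ℕ.* k) ≋ + 1 + + 125 * (+ 5) ^ s * + k * h y [ 5 ℕ.^ (10 ℕ.+ s) ]
power≋h v s k =
  subst₂ (λ z w → z ≋ + 1 + + 125 * (+ 5) ^ s * + k * w [ 5 ℕ.^ (10 ℕ.+ s) ])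
    (trans (cong (λ z → z ^ k) (sym (5^-power v (4 ℕ.+ s)))) (ℤ.^-*-assoc (+ 1 + v * + 5) (5 ℕ.^ (4 ℕ.+ s)) k))
    (sym (h-ℓ v))
    (^-first-order-mod ((+ 5) ^ s) (+ 5 * (+ 5) ^ (4 ℕ.+ s)) (quot v (4 ℕ.+ s)) (ℓ v) k
      (lemma ((+ 5) ^ s)) (quot≋ℓ v s)
      (trans (pos-^ 5 (10 ℕ.+ s)) (ℤ.^-distribˡ-+-* (+ 5) 10 s)))
  where
  lemma : ∀ p → + 5 * (+ 5 * (+ 5 * (+ 5 * (+ 5 * p)))) ≡ p * + 3125
  lemma = solve-∀

-- Euler's totient of a power of 5

∤5⇒coprime-5^ : ∀ {i} → ¬ 5 ℕ.∣ i → ∀ m → Coprime i (5 ℕ.^ m)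
∤5⇒coprime-5^ 5∤i zero    (_ , d∣1) = ℕ.∣1⇒≡1 d∣1
∤5⇒coprime-5^ {i} 5∤i (suc m) {d} (d∣i , d∣5^) =
  ∤5⇒coprime-5^ 5∤i m (d∣i , Coprimality.coprime-divisor coprime-d-5 d∣5^)
  where
  coprime-d-5 : Coprime d 5
  coprime-d-5 {e} (e∣d , e∣5) with prime⇒irreducible (from-yes (prime? 5)) e∣5
  ... | inj₁ e≡1 = e≡1
  ... | inj₂ refl = contradiction (ℕ.∣-trans e∣d d∣i) 5∤i

∣5⇒¬coprime-5^ : ∀ {i} → 5 ℕ.∣ i → ∀ m → ¬ Coprime i (5 ℕ.^ suc m)
∣5⇒¬coprime-5^ 5∣i m coprime with () ← coprime (5∣i , ℕ.m∣m*n (5 ℕ.^ m))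

module _ {p} {P : Pred ℕ p} (P? : Decidable P) where

  count : ℕ → ℕ
  count n = length (filter P? (applyUpTo suc n))

  count-suc : ∀ n → count (suc n) ≡ length (filter P? (suc n ∷ [])) ℕ.+ count n
  count-suc n = begin
    length (filter P? (applyUpTo suc (suc n)))
      ≡⟨ cong (λ l → length (filter P? l)) (List.applyUpTo-∷ʳ suc n) ⟨
    length (filter P? (applyUpTo suc n ++ suc n ∷ []))
      ≡⟨ cong length (List.filter-++ P? (applyUpTo suc n) (suc n ∷ [])) ⟩
    length (filter P? (applyUpTo suc n) ++ filter P? (suc n ∷ []))
      ≡⟨ List.length-++-comm (filter P? (applyUpTo suc n)) _ ⟩
    length (filter P? (suc n ∷ []) ++ filter P? (applyUpTo suc n))
      ≡⟨ List.length-++ (filter P? (suc n ∷ [])) ⟩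
    length (filter P? (suc n ∷ [])) ℕ.+ count n ∎
    where open ≡-Reasoning

  count-accept : ∀ n → P (suc n) → count (suc n) ≡ suc (count n)
  count-accept n p = trans (count-suc n) (cong (λ l → length l ℕ.+ count n) (List.filter-accept P? p))

  count-reject : ∀ n → ¬ P (suc n) → count (suc n) ≡ count n
  count-reject n ¬p = trans (count-suc n) (cong (λ l → length l ℕ.+ count n) (List.filter-reject P? ¬p))

  count-nonmultiples-of-5 : (∀ {i} → ¬ 5 ℕ.∣ i → P i) → (∀ {i} → 5 ℕ.∣ i → ¬ P i) →
                            ∀ q → count (q ℕ.* 5) ≡ q ℕ.* 4
  count-nonmultiples-of-5 accept reject zero    = refl
  count-nonmultiples-of-5 accept reject (suc q) =
    -- The range starts at 1, so each block of five ends with its multiple of 5, which is peeled off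
    -- before the other four.
    trans (count-reject (4 ℕ.+ q ℕ.* 5) (reject (ℕ.divides (suc q) refl)))
      (trans (count-accept (3 ℕ.+ q ℕ.* 5) (accept (5∤r+5q 4 (from-no (5 ℕ.∣? 4)))))
        (cong suc (trans (count-accept (2 ℕ.+ q ℕ.* 5) (accept (5∤r+5q 3 (from-no (5 ℕ.∣? 3)))))
          (cong suc (trans (count-accept (1 ℕ.+ q ℕ.* 5) (accept (5∤r+5q 2 (from-no (5 ℕ.∣? 2)))))
            (cong suc (trans (count-accept (q ℕ.* 5) (accept (5∤r+5q 1 (from-no (5 ℕ.∣? 1)))))
              (cong suc (count-nonmultiples-of-5 accept reject q)))))))))
    where
    5∤r+5q : ∀ r → ¬ 5 ℕ.∣ r → ¬ 5 ℕ.∣ r ℕ.+ q ℕ.* 5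
    5∤r+5q r 5∤r 5∣ = 5∤r (ℕ.∣m+n∣m⇒∣n (subst (5 ℕ.∣_) (ℕ.+-comm r (q ℕ.* 5)) 5∣) (ℕ.n∣m*n q))

φ-5^ : ∀ m → φ (5 ℕ.^ suc m) ≡ 4 ℕ.* 5 ℕ.^ m
φ-5^ m = begin
  count coprime-5^? (5 ℕ.^ suc m)      ≡⟨ cong (count coprime-5^?) (ℕ.*-comm 5 (5 ℕ.^ m)) ⟩
  count coprime-5^? (5 ℕ.^ m ℕ.* 5)
    ≡⟨ count-nonmultiples-of-5 coprime-5^?
         (λ 5∤i → ∤5⇒coprime-5^ 5∤i (suc m)) (λ 5∣i → ∣5⇒¬coprime-5^ 5∣i m) (5 ℕ.^ m) ⟩
  5 ℕ.^ m ℕ.* 4                        ≡⟨ ℕ.*-comm (5 ℕ.^ m) 4 ⟩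
  4 ℕ.* 5 ℕ.^ m                        ∎
  where
  open ≡-Reasoning
  coprime-5^? : Decidable (λ i → Coprime i (5 ℕ.^ suc m))
  coprime-5^? i = coprime? i (5 ℕ.^ suc m)

-- Residues of S n modulo 5⁷

∣-⇒≋ : ∀ {n x y} → n ℕ.∣ ∣ x - y ∣ → x ≋ y [ n ]
∣-⇒≋ {n} {x} {y} n∣ = ≋-trans (≡⇒≋ (split x y))
  (≋-trans (≋-+ {x = x - y} (∣⇒≋0 n∣) (≡⇒≋ {x = y} refl)) (≡⇒≋ (ℤ.+-identityˡ y)))
  where
  split : ∀ x y → x ≡ x - y + y
  split = solve-∀

nth : List ℕ → ℕ → ℕ
nth []       _       = 0
nth (x ∷ xs) zero    = x
nth (x ∷ xs) (suc n) = nth xs n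

-- The largest index needed is 39 = 3 + 4 · (5 + 4): residue r ≤ 3, power l ≤ 5 of y in `h`, base
-- point t ≤ 4.
residues : List ℕ
residues =
  1 ∷ 78124 ∷ 78122 ∷ 11 ∷ 57 ∷ 77764 ∷ 75362 ∷ 24611 ∷ 16362 ∷ 17584 ∷ 59102 ∷ 77986 ∷ 6542
  ∷ 56329 ∷ 52017 ∷ 24386 ∷ 51972 ∷ 65249 ∷ 54982 ∷ 1686 ∷ 10902 ∷ 78094 ∷ 71997 ∷ 63386 ∷
  10332 ∷ 19239 ∷ 41437 ∷ 69236 ∷ 42887 ∷ 44309 ∷ 1677 ∷ 60236 ∷ 32442 ∷ 52679 ∷ 53592 ∷
  24261 ∷ 55997 ∷ 12474 ∷ 41807 ∷ 67936 ∷ []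

τ : ℕ → ℤ
τ n = + nth residues n

τ-step : ℕ → ℤ
τ-step zero    = + 1
τ-step (suc n) = + 1 - (∑[ j < suc n ] (coeff (suc n) (toℕ j) * τ (toℕ j)))

-- The recurrence is checked on the table, so that `S` with its branching recursion is never
-- evaluated.
τ-recurrence : ∀ {n} → n < 40 → 78125 ℕ.∣ ∣ τ-step n - τ n ∣
τ-recurrence = from-yes (ℕ.allUpTo? (λ n → 78125 ℕ.∣? ∣ τ-step n - τ n ∣) 40)

S≋τ : ∀ n → n < 40 → S n ≋ τ n [ 78125 ]
S≋τ = <-rec _ step′
  where
  step′ : ∀ n → (∀ {j} → j < n → j < 40 → S j ≋ τ j [ 78125 ]) → n < 40 → S n ≋ τ n [ 78125 ]
  step′ zero    _  n< = ≡⇒≋ refl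
  step′ (suc n) ih n< = ≋-trans (≡⇒≋ (S-suc n))
    (≋-trans (≋-- (≡⇒≋ {x = + 1} refl) (∑-≋ (suc n) (λ j →
        ≋-*ˡ (coeff (suc n) (toℕ j)) (ih (Fin.toℕ<n j) (ℕ.<-trans (Fin.toℕ<n j) n<)))))
      (∣-⇒≋ (τ-recurrence n<)))

-- Fifth differences

-- Serves both for the difference operator `Δ⁵` and for the expansion of `h` in powers of y.
lin : List ℤ → (ℕ → ℤ) → ℤ
lin []       f = + 0
lin (c ∷ cs) f = c * f 0 + lin cs (λ l → f (suc l))

lin-≋ : ∀ {n} cs {f g} → (∀ l → l < length cs → f l ≋ g l [ n ]) → lin cs f ≋ lin cs g [ n ]
lin-≋ []       p = ≡⇒≋ refl
lin-≋ (c ∷ cs) p = ≋-+ (≋-*ˡ c (p 0 (s≤s z≤n))) (lin-≋ cs (λ l l< → p (suc l) (s≤s l<)))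

lin-cong : ∀ cs {f g} → (∀ l → f l ≡ g l) → lin cs f ≡ lin cs g
lin-cong []       p = refl
lin-cong (c ∷ cs) p = cong₂ _+_ (cong (_*_ c) (p 0)) (lin-cong cs (λ l → p (suc l)))

I-lin : ∀ M cs (f : ℕ → ℤ → ℤ) → I M (λ x → lin cs (λ l → f l x)) ≡ lin cs (λ l → I M (f l))
I-lin M []       f = I-0 M
I-lin M (c ∷ cs) f = trans (I-+ M (λ x → c * f 0 x) (λ x → lin cs (λ l → f (suc l) x)))
  (cong₂ _+_ (I-* M c (f 0)) (I-lin M cs (λ l → f (suc l))))

Δ⁵ : List ℤ
Δ⁵ = - + 1 ∷ + 5 ∷ - + 10 ∷ + 10 ∷ - + 5 ∷ + 1 ∷ []

below-5 : ∀ {P : ℕ → Set} → P 0 → P 1 → P 2 → P 3 → P 4 → ∀ l → l < 5 → P l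
below-5 p₀ p₁ p₂ p₃ p₄ 0 _ = p₀
below-5 p₀ p₁ p₂ p₃ p₄ 1 _ = p₁
below-5 p₀ p₁ p₂ p₃ p₄ 2 _ = p₂
below-5 p₀ p₁ p₂ p₃ p₄ 3 _ = p₃
below-5 p₀ p₁ p₂ p₃ p₄ 4 _ = p₄
below-5 _  _  _  _  _  (suc (suc (suc (suc (suc _))))) (s≤s (s≤s (s≤s (s≤s (s≤s ())))))

-- The leading coefficient of `Δ⁵` is 1, so any five consecutive values determine the next one.
Δ⁵-unique : ∀ {n} (f g : ℕ → ℤ) → (∀ t → lin Δ⁵ (λ l → f (l ℕ.+ t)) ≋ + 0 [ n ]) →
            (∀ t → lin Δ⁵ (λ l → g (l ℕ.+ t)) ≋ + 0 [ n ]) →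
            (∀ {t} → t < 5 → f t ≋ g t [ n ]) → ∀ t → f t ≋ g t [ n ]
Δ⁵-unique f g Δf Δg base 0 = base (s≤s z≤n)
Δ⁵-unique f g Δf Δg base 1 = base (s≤s (s≤s z≤n))
Δ⁵-unique f g Δf Δg base 2 = base (s≤s (s≤s (s≤s z≤n)))
Δ⁵-unique f g Δf Δg base 3 = base (s≤s (s≤s (s≤s (s≤s z≤n))))
Δ⁵-unique f g Δf Δg base 4 = base (s≤s (s≤s (s≤s (s≤s (s≤s z≤n)))))
Δ⁵-unique {n} f g Δf Δg base (suc (suc (suc (suc (suc t))))) =
  ≋-trans (≡⇒≋ (top (f t) (f (1 ℕ.+ t)) (f (2 ℕ.+ t)) (f (3 ℕ.+ t)) (f (4 ℕ.+ t)) (f (5 ℕ.+ t))))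
    (≋-trans (≋-- (≋-trans (Δf t) (≋-sym (Δg t)))
                  (lin-≋ lower {λ l → f (l ℕ.+ t)} {λ l → g (l ℕ.+ t)}
                    (below-5 {λ l → f (l ℕ.+ t) ≋ g (l ℕ.+ t) [ n ]}
                      (Δ⁵-unique f g Δf Δg base t)
                      (Δ⁵-unique f g Δf Δg base (suc t))
                      (Δ⁵-unique f g Δf Δg base (suc (suc t)))
                      (Δ⁵-unique f g Δf Δg base (suc (suc (suc t))))
                      (Δ⁵-unique f g Δf Δg base (suc (suc (suc (suc t))))))))
      (≡⇒≋ (sym (top (g t) (g (1 ℕ.+ t)) (g (2 ℕ.+ t)) (g (3 ℕ.+ t)) (g (4 ℕ.+ t)) (g (5 ℕ.+ t))))))
  where
  lower : List ℤ
  lower = - + 1 ∷ + 5 ∷ - + 10 ∷ + 10 ∷ - + 5 ∷ []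
  top : ∀ a b c d e z → z ≡
    (- + 1 * a + (+ 5 * b + (- + 10 * c + (+ 10 * d + (- + 5 * e + (+ 1 * z + + 0))))))
    - (- + 1 * a + (+ 5 * b + (- + 10 * c + (+ 10 * d + (- + 5 * e + + 0)))))
  top = solve-∀

-- Only the leading term survives, with 5! = 120; s is the spacing of the points, later 4.
Δ⁵-quintic : ∀ k a b c d e f x s →
  lin Δ⁵ (λ l → k * quintic a b c d e f (x + + l * s)) ≡ k * (+ 120 * f * (s * s * s * s * s))
Δ⁵-quintic = lemma
  where
  lemma : ∀ k a b c d e f x s →
    (- + 1 * (k * (a + (x + + 0 * s) * (b + (x + + 0 * s) * (c + (x + + 0 * s) * (d + (x + + 0 * s) * (e + (x + + 0 * s) * f))))))
    + (+ 5 * (k * (a + (x + + 1 * s) * (b + (x + + 1 * s) * (c + (x + + 1 * s) * (d + (x + + 1 * s) * (e + (x + + 1 * s) * f))))))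
    + (- + 10 * (k * (a + (x + + 2 * s) * (b + (x + + 2 * s) * (c + (x + + 2 * s) * (d + (x + + 2 * s) * (e + (x + + 2 * s) * f))))))
    + (+ 10 * (k * (a + (x + + 3 * s) * (b + (x + + 3 * s) * (c + (x + + 3 * s) * (d + (x + + 3 * s) * (e + (x + + 3 * s) * f))))))
    + (- + 5 * (k * (a + (x + + 4 * s) * (b + (x + + 4 * s) * (c + (x + + 4 * s) * (d + (x + + 4 * s) * (e + (x + + 4 * s) * f))))))
    + (+ 1 * (k * (a + (x + + 5 * s) * (b + (x + + 5 * s) * (c + (x + + 5 * s) * (d + (x + + 5 * s) * (e + (x + + 5 * s) * f))))))
    + + 0))))))
    ≡ k * (+ 120 * f * (s * s * s * s * s))
  lemma = solve-∀

-- Sums of x^b · 5 log (x⁴) for b = r + 4t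

weight : ℕ → ℕ → ℤ → ℤ
weight r t x = x ^ r * (x ^ 4) ^ t * h (x ^ 4)

-- h (x ^ 4) contributes 5² and the fifth difference (x ^ 4 − 1)⁵ contributes 5⁵.
Δ⁵-weight : ∀ r t x → Unit x → lin Δ⁵ (λ l → weight r (l ℕ.+ t) x) ≋ + 0 [ 78125 ]
Δ⁵-weight r t x (v by eq) =
  subst (λ y → lin Δ⁵ (λ l → x ^ r * y ^ (l ℕ.+ t) * h y) ≋ + 0 [ 78125 ]) (sym eq)
    ((v * v * v * v * v * (x ^ r * y ^ t * ℓ v)) by
      trans (difference (x ^ r) (v * + 5) (y ^ t) (h y))
        (trans (cong (λ z → v * + 5 * (v * + 5) * (v * + 5) * (v * + 5) * (v * + 5) * (x ^ r * y ^ t * z))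
                 (h-ℓ v))
          (collect (x ^ r) v (y ^ t) (ℓ v) (+ 5))))
  where
  y : ℤ
  y = + 1 + v * + 5
  difference : ∀ p u z w → let y = + 1 + u in
    - + 1 * (p * z * w) + (+ 5 * (p * (y * z) * w) + (- + 10 * (p * (y * (y * z)) * w)
    + (+ 10 * (p * (y * (y * (y * z))) * w) + (- + 5 * (p * (y * (y * (y * (y * z)))) * w)
    + (+ 1 * (p * (y * (y * (y * (y * (y * z))))) * w) + + 0)))))
    ≡ u * u * u * u * u * (p * z * w)
  difference = solve-∀
  collect : ∀ p v z l c → v * c * (v * c) * (v * c) * (v * c) * (v * c) * (p * z * (c * c * l)) ≡
    + 0 + v * v * v * v * v * (p * z * l) * (c * c * c * c * c * c * c)
  collect = solve-∀

^-4-split : ∀ r t x → x ^ (r ℕ.+ t ℕ.* 4) ≡ x ^ r * (x ^ 4) ^ t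
^-4-split r t x = trans (ℤ.^-distribˡ-+-* x r (t ℕ.* 4))
  (cong (_*_ (x ^ r)) (trans (cong (_^_ x) (ℕ.*-comm t 4)) (sym (ℤ.^-*-assoc x 4 t))))

h-coefficients : List ℤ
h-coefficients = + 1374 ∷ - + 2600 ∷ + 1100 ∷ + 100 ∷ + 25 ∷ + 1 ∷ []

I-weight : ∀ M r t → I M (weight r t) ≡ lin h-coefficients (λ l → U M (r ℕ.+ (l ℕ.+ t) ℕ.* 4))
I-weight M r t = trans (I-cong M expand) (I-lin M h-coefficients (λ l x → x ^ (r ℕ.+ (l ℕ.+ t) ℕ.* 4)))
  where
  horner : ∀ a b c d e f p y z →
    p * z * (a + y * (b + y * (c + y * (d + y * (e + y * f))))) ≡
    a * (p * z) + (b * (p * (y * z)) + (c * (p * (y * (y * z))) + (d * (p * (y * (y * (y * z))))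
    + (e * (p * (y * (y * (y * (y * z))))) + (f * (p * (y * (y * (y * (y * (y * z)))))) + + 0)))))
  horner = solve-∀
  quintic-lin : ∀ a b c d e f p y → p * y ^ t * quintic a b c d e f y ≡
    lin (a ∷ b ∷ c ∷ d ∷ e ∷ f ∷ []) (λ l → p * y ^ (l ℕ.+ t))
  quintic-lin a b c d e f p y = horner a b c d e f p y (y ^ t)
  expand : ∀ x → weight r t x ≡ lin h-coefficients (λ l → x ^ (r ℕ.+ (l ℕ.+ t) ℕ.* 4))
  expand x = trans (quintic-lin (+ 1374) (- + 2600) (+ 1100) (+ 100) (+ 25) (+ 1) (x ^ r) (x ^ 4))
    (lin-cong h-coefficients (λ l → sym (^-4-split r (l ℕ.+ t) x)))

odd-5^ : ∀ n → Odd (5 ℕ.^ n)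
odd-5^ zero    = 0 , refl
odd-5^ (suc n) = subst Odd (ℕ.*-comm (5 ℕ.^ n) 5) (odd-*5 (odd-5^ n))

5^-∣ : ∀ {m n} → m ≤ n → 5 ℕ.^ m ℕ.∣ 5 ℕ.^ n
5^-∣ {m} m≤n with o , refl ← ℕ.m≤n⇒∃[o]m+o≡n m≤n =
  subst (5 ℕ.^ m ℕ.∣_) (sym (ℕ.^-distribˡ-+-* 5 m o)) (ℕ.m∣m*n (5 ℕ.^ o))

10+s≤5^ : ∀ s → 10 ℕ.+ s ≤ 5 ℕ.^ (4 ℕ.+ s)
-- 10 + 615 = 5⁴.
10+s≤5^ zero    = ℕ.m≤m+n 10 615
10+s≤5^ (suc s) = ℕ.≤-trans (ℕ.≤-reflexive (ℕ.+-suc 10 s))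
  (ℕ.≤-trans (s≤s (10+s≤5^ s)) (1+n≤5n (5 ℕ.^ (4 ℕ.+ s)) (ℕ.m^n>0 5 (4 ℕ.+ s))))
  where
  1+n≤5n : ∀ n → 1 ≤ n → 1 ℕ.+ n ≤ 5 ℕ.* n
  1+n≤5n n 1≤n = ℕ.≤-trans (ℕ.+-monoˡ-≤ n 1≤n) (ℕ.+-monoʳ-≤ n (ℕ.m≤m+n n (3 ℕ.* n)))

T : ℕ → ℤ
T n = (+ 1 + (+ 5) ^ n) * τ n

expected : ℕ → ℕ → ℤ
expected r t = lin h-coefficients (λ l → T (r ℕ.+ (l ℕ.+ t) ℕ.* 4))

-- The exponent is 0 when r, l and t are all 0, so `U≋S-weak` is used; it suffices since M itself is
-- a multiple of 5⁷.
I-weight≋T : ∀ {M} → Odd M → 78125 ℕ.∣ M → ∀ r → r ≤ 3 → ∀ {t} → t < 5 →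
  I M (weight r t) ≋ expected r t [ 78125 ]
I-weight≋T {M} odd 5^7∣M r r≤3 {t} (s≤s t≤4) =
  ≋-trans (≡⇒≋ (I-weight M r t)) (lin-≋ h-coefficients U≋T)
  where
  U≋T : ∀ l → l < 6 → U M (r ℕ.+ (l ℕ.+ t) ℕ.* 4) ≋ T (r ℕ.+ (l ℕ.+ t) ℕ.* 4) [ 78125 ]
  U≋T l (s≤s l≤5) = ≋-trans (≋-weaken 5^7∣M (U≋S-weak odd n)) (≋-*ˡ (+ 1 + (+ 5) ^ n)
    (S≋τ n (s≤s (ℕ.+-mono-≤ r≤3 (ℕ.*-monoˡ-≤ 4 (ℕ.+-mono-≤ l≤5 t≤4))))))
    where
    n : ℕ
    n = r ℕ.+ (l ℕ.+ t) ℕ.* 4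

-- The change of `S` from b to kφ(5^m) + b

^-difference : ∀ k s b x → Unit x →
  x ^ (k ℕ.* (4 ℕ.* 5 ℕ.^ (4 ℕ.+ s)) ℕ.+ b)
  ≋ x ^ b + + 125 * (+ 5) ^ s * + k * (x ^ b * h (x ^ 4)) [ 5 ℕ.^ (10 ℕ.+ s) ]
^-difference k s b x (v by eq) = ≋-trans (≡⇒≋ split)
  (≋-trans (≋-* (subst (λ y → y ^ (5 ℕ.^ (4 ℕ.+ s) ℕ.* k)
                              ≋ + 1 + + 125 * (+ 5) ^ s * + k * h y [ 5 ℕ.^ (10 ℕ.+ s) ])
                   (sym eq) (power≋h v s k))
                (≡⇒≋ {x = x ^ b} refl))
    (≡⇒≋ (lemma (+ 125 * (+ 5) ^ s * + k) (h (x ^ 4)) (x ^ b))))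
  where
  lemma : ∀ c h z → (+ 1 + c * h) * z ≡ z + c * (z * h)
  lemma = solve-∀
  split : x ^ (k ℕ.* (4 ℕ.* 5 ℕ.^ (4 ℕ.+ s)) ℕ.+ b) ≡ (x ^ 4) ^ (5 ℕ.^ (4 ℕ.+ s) ℕ.* k) * x ^ b
  split = trans (ℤ.^-distribˡ-+-* x (k ℕ.* (4 ℕ.* 5 ℕ.^ (4 ℕ.+ s))) b)
    (cong (λ z → z * x ^ b) (trans
      (cong (_^_ x) (trans (ℕ.*-comm k (4 ℕ.* 5 ℕ.^ (4 ℕ.+ s))) (ℕ.*-assoc 4 (5 ℕ.^ (4 ℕ.+ s)) k)))
      (sym (ℤ.^-*-assoc x 4 (5 ℕ.^ (4 ℕ.+ s) ℕ.* k)))))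

U≋S-positive : ∀ {M} → Odd M → ∀ n → 1 ≤ n → U M n ≋ (+ 1 + (+ 5) ^ n) * S n [ 5 ℕ.* M ]
U≋S-positive odd (suc n) _ = U≋S-suc odd n

U≋S-large : ∀ s n → 10 ℕ.+ s ≤ n → U (5 ℕ.^ (9 ℕ.+ s)) n ≋ S n [ 5 ℕ.^ (10 ℕ.+ s) ]
U≋S-large s n 10+s≤n = ≋-trans (U≋S-positive (odd-5^ (9 ℕ.+ s)) n (ℕ.≤-trans (s≤s z≤n) 10+s≤n))
  (≋-trans (≋-* {x = + 1 + (+ 5) ^ n} {+ 1 + + 0} {S n} {S n} (≋-+ {x = + 1} (≡⇒≋ refl) 5^n≋0) (≡⇒≋ refl))
    (≡⇒≋ (ℤ.*-identityˡ (S n))))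
  where
  5^n≋0 : (+ 5) ^ n ≋ + 0 [ 5 ℕ.^ (10 ℕ.+ s) ]
  5^n≋0 = subst (λ z → z ≋ + 0 [ 5 ℕ.^ (10 ℕ.+ s) ]) (pos-^ 5 n) (∣⇒≋0 (5^-∣ 10+s≤n))

-- The choice M = 5^(9+s) makes 5M the final modulus 5^(m+5) for m = 5 + s.
S-difference : ∀ k s b → 1 ≤ b → 1 ≤ k →
  S (k ℕ.* (4 ℕ.* 5 ℕ.^ (4 ℕ.+ s)) ℕ.+ b) - (+ 1 + (+ 5) ^ b) * S b
  ≋ + 125 * (+ 5) ^ s * + k * I (5 ℕ.^ (9 ℕ.+ s)) (λ x → x ^ b * h (x ^ 4)) [ 5 ℕ.^ (10 ℕ.+ s) ]
S-difference k s b 1≤b 1≤k = ≋-trans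
  (≋-- {x = S n} {U M b + κ * J} {(+ 1 + (+ 5) ^ b) * S b} {U M b}
    (≋-trans (≋-sym (U≋S-large s n large)) U-difference)
    (≋-sym (U≋S-positive (odd-5^ (9 ℕ.+ s)) b 1≤b)))
  (≡⇒≋ (cancel (U M b) (κ * J)))
  where
  n M : ℕ
  n = k ℕ.* (4 ℕ.* 5 ℕ.^ (4 ℕ.+ s)) ℕ.+ b
  M = 5 ℕ.^ (9 ℕ.+ s)
  κ J : ℤ
  κ = + 125 * (+ 5) ^ s * + k
  J = I M (λ x → x ^ b * h (x ^ 4))

  large : 10 ℕ.+ s ≤ n
  large = ℕ.≤-trans (10+s≤5^ s) (ℕ.≤-trans (ℕ.m≤n*m (5 ℕ.^ (4 ℕ.+ s)) 4)
    (ℕ.≤-trans (ℕ.m≤n*m (4 ℕ.* 5 ℕ.^ (4 ℕ.+ s)) k {{ℕ.>-nonZero 1≤k}}) (ℕ.m≤m+n _ b)))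

  U-difference : U M n ≋ U M b + κ * J [ 5 ℕ.^ (10 ℕ.+ s) ]
  U-difference = ≋-trans
    (I-≋ M {λ x → x ^ n} {λ x → x ^ b + κ * (x ^ b * h (x ^ 4))} (^-difference k s b))
    (≡⇒≋ (trans (I-+ M (λ x → x ^ b) (λ x → κ * (x ^ b * h (x ^ 4))))
                (cong (_+_ (U M b)) (I-* M κ (λ x → x ^ b * h (x ^ 4))))))

  cancel : ∀ u v → u + v - u ≡ v
  cancel = solve-∀

-- Comparison with the claimed polynomials

module _ (a b c d e f : ℤ) (r : ℕ) (r≤3 : r ≤ 3) where

  -- The leading coefficient is a multiple of 5⁵ to make the fifth differences of 5 P vanish
  -- modulo 5⁷. P is compared through 5 P because h is 5 log y.
  P : ℤ → ℤ
  P = quintic a b c d e (f * + 3125)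

  Δ⁵-P : ∀ t → lin Δ⁵ (λ l → + 5 * P (+ (r ℕ.+ (l ℕ.+ t) ℕ.* 4))) ≋ + 0 [ 78125 ]
  Δ⁵-P t = ≋-trans (≡⇒≋ (trans
             (lin-cong Δ⁵ {g = λ l → + 5 * P (+ (r ℕ.+ t ℕ.* 4) + + l * + 4)}
               (λ l → cong (λ x → + 5 * P x) (shift l)))
             (Δ⁵-quintic (+ 5) a b c d e (f * + 3125) (+ (r ℕ.+ t ℕ.* 4)) (+ 4))))
      -- 24576 = 24 · 4⁵; one factor 5 from 5 P and one from 5! raise the 5⁵ of the leading
      -- coefficient to 5⁷.
      ((f * + 24576) by lemma f (+ 3125) (+ 4) (+ 5))
    where
    lemma : ∀ f q s v → v * (v * + 24 * (f * q) * (s * s * s * s * s))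
            ≡ + 0 + f * (+ 24 * (s * s * s * s * s)) * (q * (v * v))
    lemma = solve-∀
    shift : ∀ l → + (r ℕ.+ (l ℕ.+ t) ℕ.* 4) ≡ + (r ℕ.+ t ℕ.* 4) + + l * + 4
    shift l = trans
      (cong +_ (trans (cong (r ℕ.+_) (trans (ℕ.*-distribʳ-+ 4 l t) (ℕ.+-comm (l ℕ.* 4) (t ℕ.* 4))))
                      (sym (ℕ.+-assoc r (t ℕ.* 4) (l ℕ.* 4)))))
      (cong (_+_ (+ (r ℕ.+ t ℕ.* 4))) (ℤ.pos-* l 4))

  Δ⁵-I-weight : ∀ M t → lin Δ⁵ (λ l → I M (weight r (l ℕ.+ t))) ≋ + 0 [ 78125 ]
  Δ⁵-I-weight M t = ≋-trans (≡⇒≋ (sym (I-lin M Δ⁵ (λ l → weight r (l ℕ.+ t)))))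
    (≋-trans (I-≋ M {λ x → lin Δ⁵ (λ l → weight r (l ℕ.+ t) x)} {λ _ → + 0} (Δ⁵-weight r t)) (≡⇒≋ (I-0 M)))

  I-weight≋P : (∀ {t} → t < 5 → 78125 ℕ.∣ ∣ expected r t - + 5 * P (+ (r ℕ.+ t ℕ.* 4)) ∣) →
               ∀ {M} → Odd M → 78125 ℕ.∣ M →
               ∀ t → I M (weight r t) ≋ + 5 * P (+ (r ℕ.+ t ℕ.* 4)) [ 78125 ]
  I-weight≋P check {M} odd 5^7∣M = Δ⁵-unique (λ t → I M (weight r t)) (λ t → + 5 * P (+ (r ℕ.+ t ℕ.* 4)))
    (Δ⁵-I-weight M) Δ⁵-P base
    where
    base : ∀ {t} → t < 5 → I M (weight r t) ≋ + 5 * P (+ (r ℕ.+ t ℕ.* 4)) [ 78125 ]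
    base {t} t<5 = ≋-trans (I-weight≋T odd 5^7∣M r r≤3 {t} t<5)
      (∣-⇒≋ {x = expected r t} {+ 5 * P (+ (r ℕ.+ t ℕ.* 4))} (check {t} t<5))

  -- The prefactor 5^(3+s) turns the modulus 5⁷ into 5^(10+s), and together with the 5 of 5 P it
  -- becomes 5^(m-1).
  S-difference-quintic : (∀ {t} → t < 5 → 78125 ℕ.∣ ∣ expected r t - + 5 * P (+ (r ℕ.+ t ℕ.* 4)) ∣) →
    ∀ k s t → let n = r ℕ.+ t ℕ.* 4 in 1 ≤ n → 1 ≤ k →
    S (k ℕ.* (4 ℕ.* 5 ℕ.^ (4 ℕ.+ s)) ℕ.+ n) - (+ 1 + (+ 5) ^ n) * S n
    ≋ (+ 5) ^ (4 ℕ.+ s) * + k * P (+ n) [ 5 ℕ.^ (10 ℕ.+ s) ]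
  S-difference-quintic check k s t 1≤n 1≤k = ≋-trans (S-difference k s n 1≤n 1≤k)
    ((+ k * q) by (begin
      + 125 * p * + k * J
        ≡⟨ cong (λ z → + 125 * p * + k * z)
             (trans (I-cong M (λ x → cong (λ z → z * h (x ^ 4)) (^-4-split r t x))) J≡) ⟩
      + 125 * p * + k * (+ 5 * P (+ n) + q * + 78125)
        ≡⟨ lemma p (+ k) (P (+ n)) q (+ 5) (+ 78125) ⟩
      (+ 5) ^ (4 ℕ.+ s) * + k * P (+ n) + + k * q * (+ 9765625 * p)
        ≡⟨ cong (λ z → (+ 5) ^ (4 ℕ.+ s) * + k * P (+ n) + + k * q * z)
             (trans (pos-^ 5 (10 ℕ.+ s)) (ℤ.^-distribˡ-+-* (+ 5) 10 s)) ⟨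
      (+ 5) ^ (4 ℕ.+ s) * + k * P (+ n) + + k * q * + (5 ℕ.^ (10 ℕ.+ s)) ∎))
    where
    open ≡-Reasoning
    n M : ℕ
    n = r ℕ.+ t ℕ.* 4
    M = 5 ℕ.^ (9 ℕ.+ s)
    p J : ℤ
    p = (+ 5) ^ s
    J = I M (λ x → x ^ n * h (x ^ 4))
    J≋ : I M (weight r t) ≋ + 5 * P (+ n) [ 78125 ]
    J≋ = I-weight≋P check (odd-5^ (9 ℕ.+ s)) (5^-∣ {7} (ℕ.m≤m+n 7 (2 ℕ.+ s))) t
    q : ℤ
    q = quotient J≋
    J≡ : I M (weight r t) ≡ + 5 * P (+ n) + q * + 78125
    J≡ = equality J≋
    lemma : ∀ p k z q v w → v * v * v * p * k * (v * z + q * w)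
            ≡ v * (v * (v * (v * p))) * k * z + k * q * (v * v * v * w * p)
    lemma = solve-∀

  S-congruence : (∀ {t} → t < 5 → 78125 ℕ.∣ ∣ expected r t - + 5 * P (+ (r ℕ.+ t ℕ.* 4)) ∣) →
    ∀ n k m → 1 ≤ n → 1 ≤ k → ∃ (λ s → 5 ℕ.+ s ≡ m) → n % 4 ≡ r → ∀ {z} → z ≡ P (+ n) →
    S (k ℕ.* φ (5 ℕ.^ m) ℕ.+ n) - (+ 1 + (+ 5) ^ n) * S n
    ≡ (+ 5) ^ (m ∸ 1) * + k * z [mod 5 ℕ.^ (m ℕ.+ 5) ]
  S-congruence check n k _ 1≤n 1≤k (s , refl) n%4≡r refl = ≋⇒mod
    (subst₂ (λ φ′ i → S (k ℕ.* φ′ ℕ.+ n) - (+ 1 + (+ 5) ^ n) * S n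
                      ≋ (+ 5) ^ (4 ℕ.+ s) * + k * P (+ n) [ 5 ℕ.^ i ])
      (sym (φ-5^ (4 ℕ.+ s))) (ℕ.+-comm 5 (5 ℕ.+ s))
      (subst (λ n → 1 ≤ n → S (k ℕ.* (4 ℕ.* 5 ℕ.^ (4 ℕ.+ s)) ℕ.+ n) - (+ 1 + (+ 5) ^ n) * S n
                            ≋ (+ 5) ^ (4 ℕ.+ s) * + k * P (+ n) [ 5 ℕ.^ (10 ℕ.+ s) ])
        (sym n≡) (λ 1≤n′ → S-difference-quintic check k s (n ℕ./ 4) 1≤n′ 1≤k) 1≤n))
    where
    n≡ : n ≡ r ℕ.+ n ℕ./ 4 ℕ.* 4
    n≡ = trans (m≡m%n+[m/n]*n n 4) (cong (λ z → z ℕ.+ n ℕ./ 4 ℕ.* 4) n%4≡r)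

theorem6p1 : (b k m : ℕ) → 1 ≤ b → 1 ≤ k → 5 ≤ m →
    let B = + b
        lhs = S (k ℕ.* φ (5 ℕ.^ m) ℕ.+ b) - (+ 1 + (+ 5) ^ b) * S b
        c = (+ 5) ^ (m ℕ.∸ 1) * + k
        N = 5 ℕ.^ (m ℕ.+ 5)
    in (b % 4 ≡ 0 → lhs ≡ c * (+ 930 - + 4875 * B - + 4625 * B ^ 2 - + 6250 * B ^ 3 - + 3125 * B ^ 4) [mod N ])
     × (b % 4 ≡ 1 → lhs ≡ c * (+ 4670 + + 1450 * B + + 1250 * B ^ 2 + + 6250 * B ^ 3 + + 3125 * B ^ 4 + + 6250 * B ^ 5) [mod N ])
     × (b % 4 ≡ 2 → lhs ≡ c * (- (+ 4235) + + 3700 * B - + 3000 * B ^ 2 + + 6250 * B ^ 3 - + 9375 * B ^ 4 + + 6250 * B ^ 5) [mod N ])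
     × (b % 4 ≡ 3 → lhs ≡ c * (+ 3725 - + 1025 * B - + 2625 * B ^ 2 + + 6250 * B ^ 3 + + 3125 * B ^ 5) [mod N ])
theorem6p1 b k m 1≤b 1≤k 5≤m =
    -- The last coefficient passed in each case is that of b⁵ divided by 3125, namely 0, 2, 2 and 1.
    (λ b%4≡0 → S-congruence (+ 930) (- + 4875) (- + 4625) (- + 6250) (- + 3125) (+ 0) 0 z≤n
      check₀ b k m 1≤b 1≤k (ℕ.m≤n⇒∃[o]m+o≡n 5≤m) b%4≡0
      (expand₀ (+ 930) (+ 4875) (+ 4625) (+ 6250) (+ 3125) (+ b)))
  , (λ b%4≡1 → S-congruence (+ 4670) (+ 1450) (+ 1250) (+ 6250) (+ 3125) (+ 2) 1 (ℕ.m≤m+n 1 2)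
      check₁ b k m 1≤b 1≤k (ℕ.m≤n⇒∃[o]m+o≡n 5≤m) b%4≡1
      (expand₁ (+ 4670) (+ 1450) (+ 1250) (+ 6250) (+ 3125) (+ 6250) (+ b)))
  , (λ b%4≡2 → S-congruence (- + 4235) (+ 3700) (- + 3000) (+ 6250) (- + 9375) (+ 2) 2 (ℕ.m≤m+n 2 1)
      check₂ b k m 1≤b 1≤k (ℕ.m≤n⇒∃[o]m+o≡n 5≤m) b%4≡2
      (expand₂ (+ 4235) (+ 3700) (+ 3000) (+ 6250) (+ 9375) (+ 6250) (+ b)))
  , (λ b%4≡3 → S-congruence (+ 3725) (- + 1025) (- + 2625) (+ 6250) (+ 0) (+ 1) 3 (ℕ.m≤m+n 3 0)
      check₃ b k m 1≤b 1≤k (ℕ.m≤n⇒∃[o]m+o≡n 5≤m) b%4≡3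
      (expand₃ (+ 3725) (+ 1025) (+ 2625) (+ 6250) (+ 3125) (+ b)))
  where
  P₀ P₁ P₂ P₃ : ℤ → ℤ
  P₀ = quintic (+ 930) (- + 4875) (- + 4625) (- + 6250) (- + 3125) (+ 0 * + 3125)
  P₁ = quintic (+ 4670) (+ 1450) (+ 1250) (+ 6250) (+ 3125) (+ 2 * + 3125)
  P₂ = quintic (- + 4235) (+ 3700) (- + 3000) (+ 6250) (- + 9375) (+ 2 * + 3125)
  P₃ = quintic (+ 3725) (- + 1025) (- + 2625) (+ 6250) (+ 0) (+ 1 * + 3125)

  check₀ : ∀ {t} → t < 5 → 78125 ℕ.∣ ∣ expected 0 t - + 5 * P₀ (+ (0 ℕ.+ t ℕ.* 4)) ∣
  check₀ = from-yes (ℕ.allUpTo? (λ t → 78125 ℕ.∣? ∣ expected 0 t - + 5 * P₀ (+ (0 ℕ.+ t ℕ.* 4)) ∣) 5)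
  check₁ : ∀ {t} → t < 5 → 78125 ℕ.∣ ∣ expected 1 t - + 5 * P₁ (+ (1 ℕ.+ t ℕ.* 4)) ∣
  check₁ = from-yes (ℕ.allUpTo? (λ t → 78125 ℕ.∣? ∣ expected 1 t - + 5 * P₁ (+ (1 ℕ.+ t ℕ.* 4)) ∣) 5)
  check₂ : ∀ {t} → t < 5 → 78125 ℕ.∣ ∣ expected 2 t - + 5 * P₂ (+ (2 ℕ.+ t ℕ.* 4)) ∣
  check₂ = from-yes (ℕ.allUpTo? (λ t → 78125 ℕ.∣? ∣ expected 2 t - + 5 * P₂ (+ (2 ℕ.+ t ℕ.* 4)) ∣) 5)
  check₃ : ∀ {t} → t < 5 → 78125 ℕ.∣ ∣ expected 3 t - + 5 * P₃ (+ (3 ℕ.+ t ℕ.* 4)) ∣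
  check₃ = from-yes (ℕ.allUpTo? (λ t → 78125 ℕ.∣? ∣ expected 3 t - + 5 * P₃ (+ (3 ℕ.+ t ℕ.* 4)) ∣) 5)

  expand₀ : ∀ a b c d e x → a - b * x - c * x ^ 2 - d * x ^ 3 - e * x ^ 4
            ≡ quintic a (- b) (- c) (- d) (- e) (+ 0) x
  expand₀ = lemma
    where
    lemma : ∀ a b c d e x →
      a - b * x - c * (x * (x * + 1)) - d * (x * (x * (x * + 1))) - e * (x * (x * (x * (x * + 1))))
      ≡ a + x * (- b + x * (- c + x * (- d + x * (- e + x * + 0))))
    lemma = solve-∀

  expand₁ : ∀ a b c d e f x → a + b * x + c * x ^ 2 + d * x ^ 3 + e * x ^ 4 + f * x ^ 5
            ≡ quintic a b c d e f x
  expand₁ = lemma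
    where
    lemma : ∀ a b c d e f x →
      a + b * x + c * (x * (x * + 1)) + d * (x * (x * (x * + 1))) + e * (x * (x * (x * (x * + 1))))
        + f * (x * (x * (x * (x * (x * + 1)))))
      ≡ a + x * (b + x * (c + x * (d + x * (e + x * f))))
    lemma = solve-∀

  expand₂ : ∀ a b c d e f x → - a + b * x - c * x ^ 2 + d * x ^ 3 - e * x ^ 4 + f * x ^ 5
            ≡ quintic (- a) b (- c) d (- e) f x
  expand₂ = lemma
    where
    lemma : ∀ a b c d e f x →
      - a + b * x - c * (x * (x * + 1)) + d * (x * (x * (x * + 1))) - e * (x * (x * (x * (x * + 1))))
        + f * (x * (x * (x * (x * (x * + 1)))))
      ≡ - a + x * (b + x * (- c + x * (d + x * (- e + x * f))))
    lemma = solve-∀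

  expand₃ : ∀ a b c d f x → a - b * x - c * x ^ 2 + d * x ^ 3 + f * x ^ 5
            ≡ quintic a (- b) (- c) d (+ 0) f x
  expand₃ = lemma
    where
    lemma : ∀ a b c d f x →
      a - b * x - c * (x * (x * + 1)) + d * (x * (x * (x * + 1))) + f * (x * (x * (x * (x * (x * + 1)))))
      ≡ a + x * (- b + x * (- c + x * (d + x * (+ 0 + x * f))))
    lemma = solve-∀
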